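{- Let $N\geq 1$, $R\geq 2$ and $A\geq 2$ be integers. Let $(Z,M)$ be a uniform state, and assume that all source digits used by a call Draw$(N)$ (defined in the context) are mutually independent, uniform on $[A]$, and jointly independent of $(Z,M)$. Then the total branch loss of the call, i.e. the sum of the branch losses (defined in the context) over all attempted splits made during the call, satisfies $$\mathbb{E}[\text{total branch loss}]\leq\frac{H_2(1/R)}{1-1/R}.$$
   Context: For a nonnegative integer $N$, $[N]=\{0,1,\ldots,N-1\}$. $H_2(p)=-p\log_2 p-(1-p)\log_2(1-p)$ is the binary entropy function, with $H_2(0)=H_2(1)=0$. Uniform state: a pair $(Z,M)$ of random variables, $M$ a positive integer (possibly random), such that conditionally on $M$, $Z$ is uniform on $[M]$. Procedure Draw$(N)$, with fixed integer parameters $A$ (source alphabet size) and $R\geq 2$ (rejection parameter). It reads and updates the state $(Z,M)$, using unbounded integers. Repeat the following loop until a value is returned: (1) while $(M\bmod N)\,R\geq M$: read a fresh source digit $U$ and set $(Z,M)\gets(AZ+U,\,AM)$; (2) set $q=\lfloor M/N\rfloor$ and $s=M-qN$; (3) if $Z<qN$ (accept): set $X=Z\bmod N$, update $(Z,M)\gets(\lfloor Z/N\rfloor,\,q)$, and return $X$; otherwise (reject) update $(Z,M)\gets(M-1-Z,\,s)$ and go back to (1). Each execution of steps (2)-(3) is an attempted split. For an attempted split with modulus $M$ (the value at step (2)), put $\varepsilon=s/M$. Its branch loss is $\log_2 M-\log_2(qN)=-\log_2(1-\varepsilon)$ if it accepts, and $\log_2 M-\log_2 s=-\log_2\varepsilon$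 if it rejects. -}

module Defs where

open import Algebra.Bundles.Raw using (RawMonoid)
open import Algebra.Definitions.RawMonoid using (sum)
open import Data.Bool using (if_then_else_)
open import Data.Fin using (Fin; toℕ)
open import Data.Integer as ℤ using (ℤ; +_)
import Data.Integer.Properties as ℤ
open import Data.List using (List; []; _∷_)
open import Data.Nat as ℕ
  using (ℕ; zero; suc; _+_; _*_; _∸_; _^_; _⊔_; _/_; _%_; _≤_; _<_; NonZero; NonTrivial)
import Data.Nat.Properties as ℕ
import Data.Nat.DivMod as ℕ
open import Data.Nat.Induction using (<-rec)
open import Data.Nat.Logarithm
  using (⌊log₂_⌋; ⌊log₂⌋-mono-≤; ⌊log₂⌊n/2⌋⌋≡⌊log₂n⌋∸1; ⌊log₂[2^n]⌋≡n)
open import Data.Product using (_×_; _,_; ∃; proj₁; proj₂)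
open import Data.Rational as ℚ using (ℚ; 0ℚ; 1ℚ; ½; mkℚ)
import Data.Rational.Properties as ℚ
import Data.Rational.Unnormalised as ℚᵘ
import Data.Rational.Unnormalised.Properties as ℚᵘ
open import Data.Rational.Solver using (module +-*-Solver)
open import Data.Sum using (inj₁; inj₂)
open import Data.Vec using (Vec; []; _∷_; _∷ʳ_; toList)
open import Level using (0ℓ)
open import Relation.Binary.PropositionalEquality
  using (_≡_; refl; sym; trans; cong; cong₂; subst; subst₂; module ≡-Reasoning)
open import Relation.Nullary using (does; yes; no; contradiction)

half-pos : ∀ {ε} → 0ℚ ℚ.< ε → 0ℚ ℚ.< ½ ℚ.* ε
half-pos {ε} 0<ε = subst (ℚ._< ½ ℚ.* ε) (ℚ.*-zeroʳ ½) (ℚ.*-monoʳ-<-pos ½ 0<ε)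

half+half : ∀ ε → ½ ℚ.* ε ℚ.+ ½ ℚ.* ε ≡ ε
half+half ε = trans (sym (ℚ.*-distribʳ-+ ε ½ ½)) (ℚ.*-identityˡ ε)

neg-diff : ∀ p q → ℚ.∣ ℚ.- p ℚ.- ℚ.- q ∣ ≡ ℚ.∣ p ℚ.- q ∣
neg-diff p q = trans (cong ℚ.∣_∣ eq) (ℚ.∣-p∣≡∣p∣ (p ℚ.- q))
  where
  open +-*-Solver
  eq : ℚ.- p ℚ.- ℚ.- q ≡ ℚ.- (p ℚ.- q)
  eq = solve 2 (λ p q → :- p :- :- q := :- (p :- q)) refl p q

sum-diff : ∀ p q r s →
  ℚ.∣ (p ℚ.+ r) ℚ.- (q ℚ.+ s) ∣ ℚ.≤ ℚ.∣ p ℚ.- q ∣ ℚ.+ ℚ.∣ r ℚ.- s ∣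
sum-diff p q r s = subst (λ t → ℚ.∣ t ∣ ℚ.≤ ℚ.∣ p ℚ.- q ∣ ℚ.+ ℚ.∣ r ℚ.- s ∣) (sym eq)
  (ℚ.∣p+q∣≤∣p∣+∣q∣ (p ℚ.- q) (r ℚ.- s))
  where
  open +-*-Solver
  eq : (p ℚ.+ r) ℚ.- (q ℚ.+ s) ≡ (p ℚ.- q) ℚ.+ (r ℚ.- s)
  eq = solve 4 (λ p q r s → (p :+ r) :- (q :+ s) := (p :- q) :+ (r :- s)) refl p q r s

prod-diff : ∀ p q r s →
  ℚ.∣ p ℚ.* r ℚ.- q ℚ.* s ∣ ℚ.≤ ℚ.∣ p ∣ ℚ.* ℚ.∣ r ℚ.- s ∣ ℚ.+ ℚ.∣ s ∣ ℚ.* ℚ.∣ p ℚ.- q ∣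
prod-diff p q r s = subst₂ ℚ._≤_ (cong ℚ.∣_∣ (sym eq))
  (cong₂ ℚ._+_ (ℚ.∣p*q∣≡∣p∣*∣q∣ p (r ℚ.- s)) (ℚ.∣p*q∣≡∣p∣*∣q∣ s (p ℚ.- q)))
  (ℚ.∣p+q∣≤∣p∣+∣q∣ (p ℚ.* (r ℚ.- s)) (s ℚ.* (p ℚ.- q)))
  where
  open +-*-Solver
  eq : p ℚ.* r ℚ.- q ℚ.* s ≡ p ℚ.* (r ℚ.- s) ℚ.+ s ℚ.* (p ℚ.- q)
  eq = solve 4 (λ p q r s → p :* r :- q :* s := p :* (r :- s) :+ s :* (p :- q)) refl p q r s

*-mono-∣∣ : ∀ {p q r s} → 0ℚ ℚ.≤ r → 0ℚ ℚ.≤ q → p ℚ.≤ q → r ℚ.≤ s → p ℚ.* r ℚ.≤ q ℚ.* s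
*-mono-∣∣ {p} {q} {r} {s} 0≤r 0≤q p≤q r≤s = ℚ.≤-trans
  (ℚ.*-monoʳ-≤-nonNeg r {{ℚ.nonNegative 0≤r}} p≤q)
  (ℚ.*-monoˡ-≤-nonNeg q {{ℚ.nonNegative 0≤q}} r≤s)

module Common (M N : ℕ) where
  left : ∀ {n} → M ⊔ N ≤ n → M ≤ n
  left = ℕ.≤-trans (ℕ.m≤m⊔n M N)
  right : ∀ {n} → M ⊔ N ≤ n → N ≤ n
  right = ℕ.≤-trans (ℕ.m≤n⊔m M N)

IsCauchy : (ℕ → ℚ) → Set
IsCauchy x = ∀ ε → 0ℚ ℚ.< ε →
  ∃ λ N → ∀ m n → N ≤ m → N ≤ n → ℚ.∣ x m ℚ.- x n ∣ ℚ.≤ ε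

record ℝ : Set where
  constructor mkℝ
  field
    seq    : ℕ → ℚ
    cauchy : IsCauchy seq
open ℝ public

infix 4 _≤ᵣ_ _≃ᵣ_

record _≤ᵣ_ (x y : ℝ) : Set where
  constructor mk≤
  field
    eventually : ∀ ε → 0ℚ ℚ.< ε → ∃ λ N → ∀ n → N ≤ n → seq x n ℚ.≤ seq y n ℚ.+ ε
open _≤ᵣ_ public

_≃ᵣ_ : ℝ → ℝ → Set
x ≃ᵣ y = x ≤ᵣ y × y ≤ᵣ x

abstract
  fromℚ-isCauchy : ∀ p → IsCauchy (λ _ → p)
  fromℚ-isCauchy p ε 0<ε =
    0 , λ _ _ _ _ → subst (λ t → ℚ.∣ t ∣ ℚ.≤ ε) (sym (ℚ.+-inverseʳ p)) (ℚ.<⇒≤ 0<ε)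

  neg-isCauchy : ∀ x → IsCauchy x → IsCauchy (λ n → ℚ.- x n)
  neg-isCauchy x c ε 0<ε with c ε 0<ε
  ... | N , h = N , λ m n ≤m ≤n →
    subst (ℚ._≤ ε) (sym (neg-diff (x m) (x n))) (h m n ≤m ≤n)

fromℚ : ℚ → ℝ
fromℚ p = mkℝ (λ _ → p) (fromℚ-isCauchy p)

infixl 6 _+ᵣ_ _-ᵣ_
infixl 7 _*ᵣ_
infix  8 -ᵣ_

abstract
  +-isCauchy : ∀ x y → IsCauchy x → IsCauchy y → IsCauchy (λ n → x n ℚ.+ y n)
  +-isCauchy x y cx cy ε 0<ε
    with cx (½ ℚ.* ε) (half-pos 0<ε) | cy (½ ℚ.* ε) (half-pos 0<ε)
  ... | M , hx | N , hy = M ⊔ N , λ m n ≤m ≤n → ℚ.≤-trans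
    (sum-diff (x m) (x n) (y m) (y n))
    (subst (ℚ.∣ x m ℚ.- x n ∣ ℚ.+ ℚ.∣ y m ℚ.- y n ∣ ℚ.≤_) (half+half ε)
      (ℚ.+-mono-≤ (hx m n (left ≤m) (left ≤n)) (hy m n (right ≤m) (right ≤n))))
    where open Common M N

_+ᵣ_ : ℝ → ℝ → ℝ
x +ᵣ y = mkℝ (λ n → seq x n ℚ.+ seq y n) (+-isCauchy (seq x) (seq y) (cauchy x) (cauchy y))

-ᵣ_ : ℝ → ℝ
-ᵣ x = mkℝ (λ n → ℚ.- seq x n) (neg-isCauchy (seq x) (cauchy x))

_-ᵣ_ : ℝ → ℝ → ℝ
x -ᵣ y = x +ᵣ (-ᵣ y)

eventuallyBounded : ∀ x → IsCauchy x →
  ∃ λ K → ∃ λ N → 0ℚ ℚ.< K × (∀ n → N ≤ n → ℚ.∣ x n ∣ ℚ.≤ K)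
eventuallyBounded x c = K , N , 0<K , bound
  where
  0<1 : 0ℚ ℚ.< 1ℚ
  0<1 = ℚ.positive⁻¹ 1ℚ
  N = proj₁ (c 1ℚ 0<1)
  K = ℚ.∣ x N ∣ ℚ.+ 1ℚ
  0<K : 0ℚ ℚ.< K
  0<K = ℚ.+-mono-≤-< (ℚ.0≤∣p∣ (x N)) 0<1
  split : ∀ p q → p ≡ q ℚ.+ (p ℚ.- q)
  split = solve 2 (λ p q → p := q :+ (p :- q)) refl
    where open +-*-Solver
  bound : ∀ n → N ≤ n → ℚ.∣ x n ∣ ℚ.≤ K
  bound n N≤n = ℚ.≤-trans
    (subst (λ t → ℚ.∣ t ∣ ℚ.≤ ℚ.∣ x N ∣ ℚ.+ ℚ.∣ x n ℚ.- x N ∣) (sym (split (x n) (x N)))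
      (ℚ.∣p+q∣≤∣p∣+∣q∣ (x N) (x n ℚ.- x N)))
    (ℚ.+-monoʳ-≤ ℚ.∣ x N ∣ (proj₂ (c 1ℚ 0<1) n N N≤n ℕ.≤-refl))

scale : ∀ K ε → 0ℚ ℚ.< K → 0ℚ ℚ.< ε → ∃ λ δ → 0ℚ ℚ.< δ × K ℚ.* δ ≡ ε
scale K ε 0<K 0<ε = δ , 0<δ , Kδ≡ε
  where
  instance
    K>0 : ℚ.Positive K
    K>0 = ℚ.positive 0<K
    K≢0 : ℚ.NonZero K
    K≢0 = ℚ.pos⇒nonZero K
    1/K>0 : ℚ.Positive (ℚ.1/ K)
    1/K>0 = ℚ.1/pos⇒pos K
  δ = ℚ.1/ K ℚ.* ε
  0<δ : 0ℚ ℚ.< δ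
  0<δ = subst (ℚ._< δ) (ℚ.*-zeroʳ (ℚ.1/ K)) (ℚ.*-monoʳ-<-pos (ℚ.1/ K) 0<ε)
  Kδ≡ε : K ℚ.* δ ≡ ε
  Kδ≡ε = trans (sym (ℚ.*-assoc K (ℚ.1/ K) ε))
           (trans (cong (ℚ._* ε) (ℚ.*-inverseʳ K)) (ℚ.*-identityˡ ε))

prod-bound : ∀ p q r s {K L δ η} → 0ℚ ℚ.< K → 0ℚ ℚ.< L →
  ℚ.∣ p ∣ ℚ.≤ K → ℚ.∣ s ∣ ℚ.≤ L → ℚ.∣ r ℚ.- s ∣ ℚ.≤ δ → ℚ.∣ p ℚ.- q ∣ ℚ.≤ η →
  ℚ.∣ p ℚ.* r ℚ.- q ℚ.* s ∣ ℚ.≤ K ℚ.* δ ℚ.+ L ℚ.* η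
prod-bound p q r s 0<K 0<L hp hs hr hq = ℚ.≤-trans (prod-diff p q r s)
  (ℚ.+-mono-≤ (*-mono-∣∣ (ℚ.0≤∣p∣ (r ℚ.- s)) (ℚ.<⇒≤ 0<K) hp hr)
              (*-mono-∣∣ (ℚ.0≤∣p∣ (p ℚ.- q)) (ℚ.<⇒≤ 0<L) hs hq))

abstract
  *-isCauchy : ∀ x y → IsCauchy x → IsCauchy y → IsCauchy (λ n → x n ℚ.* y n)
  *-isCauchy x y cx cy ε 0<ε =
    go (eventuallyBounded x cx) (eventuallyBounded y cy)
    where
    Bounds : (ℕ → ℚ) → Set
    Bounds z = ∃ λ K → ∃ λ N → 0ℚ ℚ.< K × (∀ n → N ≤ n → ℚ.∣ z n ∣ ℚ.≤ K)
    Goal : Set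
    Goal = ∃ λ N → ∀ m n → N ≤ m → N ≤ n → ℚ.∣ x m ℚ.* y m ℚ.- x n ℚ.* y n ∣ ℚ.≤ ε
    go : Bounds x → Bounds y → Goal
    go (K , Nx , 0<K , bx) (L , Ny , 0<L , by) =
      go′ (scale K (½ ℚ.* ε) 0<K (half-pos 0<ε)) (scale L (½ ℚ.* ε) 0<L (half-pos 0<ε))
      where
      go′ : (∃ λ δ → 0ℚ ℚ.< δ × K ℚ.* δ ≡ ½ ℚ.* ε) →
            (∃ λ η → 0ℚ ℚ.< η × L ℚ.* η ≡ ½ ℚ.* ε) → Goal
      go′ (δ , 0<δ , Kδ≡) (η , 0<η , Lη≡) with cx η 0<η | cy δ 0<δ
      ... | Mx , hx | My , hy = (Nx ⊔ Ny) ⊔ (Mx ⊔ My) , λ m n ≤m ≤n →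
        subst (ℚ.∣ x m ℚ.* y m ℚ.- x n ℚ.* y n ∣ ℚ.≤_)
          (trans (cong₂ ℚ._+_ Kδ≡ Lη≡) (half+half ε))
          (prod-bound (x m) (x n) (y m) (y n) 0<K 0<L
            (bx m (B.left (A.left ≤m))) (by n (B.right (A.left ≤n)))
            (hy m n (C.right (A.right ≤m)) (C.right (A.right ≤n)))
            (hx m n (C.left (A.right ≤m)) (C.left (A.right ≤n))))
        where
        module A = Common (Nx ⊔ Ny) (Mx ⊔ My)
        module B = Common Nx Ny
        module C = Common Mx My

_*ᵣ_ : ℝ → ℝ → ℝ
x *ᵣ y = mkℝ (λ n → seq x n ℚ.* seq y n) (*-isCauchy (seq x) (seq y) (cauchy x) (cauchy y))

+ᵣ-rawMonoid : RawMonoid 0ℓ 0ℓ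
+ᵣ-rawMonoid = record { _≈_ = _≃ᵣ_ ; _∙_ = _+ᵣ_ ; ε = fromℚ 0ℚ }

∑ : ∀ n → (Fin n → ℝ) → ℝ
∑ n f = sum +ᵣ-rawMonoid f

∑< : ℕ → (ℕ → ℝ) → ℝ
∑< n f = ∑ n λ i → f (toℕ i)

SumsTo : (ℕ → ℝ) → ℝ → Set
SumsTo f s = ∀ ε → 0ℚ ℚ.< ε → ∃ λ N → ∀ n → N ≤ n →
  ∑< n f ≤ᵣ s +ᵣ fromℚ ε × s ≤ᵣ ∑< n f +ᵣ fromℚ ε

⌊log₂⌋-lower : ∀ n .{{_ : NonZero n}} → 2 ^ ⌊log₂ n ⌋ ≤ n
⌊log₂⌋-lower n = <-rec (λ n → 1 ≤ n → 2 ^ ⌊log₂ n ⌋ ≤ n) go n (ℕ.>-nonZero⁻¹ n)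
  where
  go : ∀ n → (∀ {m} → m < n → 1 ≤ m → 2 ^ ⌊log₂ m ⌋ ≤ m) → 1 ≤ n → 2 ^ ⌊log₂ n ⌋ ≤ n
  go 1 _ _ = ℕ.≤-refl
  go n@(suc (suc k)) ih _ = begin
    2 ^ ⌊log₂ n ⌋                   ≤⟨ ℕ.^-monoʳ-≤ 2 (ℕ.m≤n+m∸n ⌊log₂ n ⌋ 1) ⟩
    2 * 2 ^ (⌊log₂ n ⌋ ∸ 1)         ≡⟨ cong (λ l → 2 * 2 ^ l) (sym (⌊log₂⌊n/2⌋⌋≡⌊log₂n⌋∸1 n)) ⟩
    2 * 2 ^ ⌊log₂ h ⌋               ≤⟨ ℕ.*-monoʳ-≤ 2 (ih (ℕ.⌊n/2⌋<n (suc k)) (ℕ.s≤s ℕ.z≤n)) ⟩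
    2 * h                           ≡⟨ cong (ℕ._+_ h) (ℕ.+-identityʳ h) ⟩
    h + h                           ≤⟨ ℕ.+-monoʳ-≤ h (ℕ.⌊n/2⌋≤⌈n/2⌉ n) ⟩
    h + ℕ.⌈ n /2⌉                   ≡⟨ ℕ.⌊n/2⌋+⌈n/2⌉≡n n ⟩
    n                               ∎
    where
    open ℕ.≤-Reasoning
    h = ℕ.⌊ n /2⌋

⌊log₂⌋-upper : ∀ n → n < 2 ^ suc ⌊log₂ n ⌋
⌊log₂⌋-upper n = ℕ.≰⇒> λ 2^≤n → ℕ.1+n≰n
  (subst (_≤ ⌊log₂ n ⌋) (⌊log₂[2^n]⌋≡n (suc ⌊log₂ n ⌋)) (⌊log₂⌋-mono-≤ 2^≤n))

-- By the two bounds above, for positive a,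
--   2 ^ ⌊log₂ aⁿ⌋ ≤ aⁿ < 2 ^ (⌊log₂ aⁿ⌋ + 1),
-- so log₂ a lies between ⌊log₂ aⁿ⌋ / n and (⌊log₂ aⁿ⌋ + 1) / n.  The sequence
-- of lower bounds is the real number log₂ a; at a = 0 it has the junk value 0.
log₂-approx : ℕ → ℕ → ℚ
log₂-approx a k = + ⌊log₂ (a ^ suc k) ⌋ ℚ./ suc k

⌊log₂^⌋-cross : ∀ a .{{_ : NonZero a}} m n →
  m * ⌊log₂ (a ^ n) ⌋ ≤ n * ⌊log₂ (a ^ m) ⌋ + n
⌊log₂^⌋-cross a m n = ℕ.≮⇒≥ λ lt → ℕ.<-irrefl refl (begin-strict
  a ^ (n * m)                            ≡⟨ sym (ℕ.^-*-assoc a n m) ⟩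
  (a ^ n) ^ m                            ≡⟨ trans (ℕ.^-*-assoc a n m) (trans (cong (a ^_) (ℕ.*-comm n m)) (sym (ℕ.^-*-assoc a m n))) ⟩
  (a ^ m) ^ n                            ≤⟨ ℕ.^-monoˡ-≤ n (ℕ.<⇒≤ (⌊log₂⌋-upper (a ^ m))) ⟩
  (2 ^ suc ⌊log₂ (a ^ m) ⌋) ^ n          ≡⟨ ℕ.^-*-assoc 2 (suc ⌊log₂ (a ^ m) ⌋) n ⟩
  2 ^ (suc ⌊log₂ (a ^ m) ⌋ * n)          ≡⟨ cong (2 ^_) (trans (ℕ.+-comm n _) (cong (_+ n) (ℕ.*-comm ⌊log₂ (a ^ m) ⌋ n))) ⟩
  2 ^ (n * ⌊log₂ (a ^ m) ⌋ + n)          <⟨ ℕ.^-monoʳ-< 2 (ℕ.s≤s (ℕ.s≤s ℕ.z≤n)) lt ⟩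
  2 ^ (m * ⌊log₂ (a ^ n) ⌋)              ≡⟨ cong (2 ^_) (ℕ.*-comm m ⌊log₂ (a ^ n) ⌋) ⟩
  2 ^ (⌊log₂ (a ^ n) ⌋ * m)              ≡⟨ sym (ℕ.^-*-assoc 2 ⌊log₂ (a ^ n) ⌋ m) ⟩
  (2 ^ ⌊log₂ (a ^ n) ⌋) ^ m              ≤⟨ ℕ.^-monoˡ-≤ m (⌊log₂⌋-lower (a ^ n) {{ℕ.m^n≢0 a n}}) ⟩
  (a ^ n) ^ m                            ≡⟨ ℕ.^-*-assoc a n m ⟩
  a ^ (n * m)                            ∎)
  where open ℕ.≤-Reasoning

/-≤ : ∀ p q m n .{{_ : NonZero m}} .{{_ : NonZero n}} →
  p * n ≤ q * m → + p ℚ./ m ℚ.≤ + q ℚ./ n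
/-≤ p q (suc m) (suc n) h = ℚ.toℚᵘ-cancel-≤
  (ℚᵘ.≤-respˡ-≃ (ℚᵘ.≃-sym (ℚ.toℚᵘ-fromℚᵘ (ℚᵘ.mkℚᵘ (+ p) m)))
    (ℚᵘ.≤-respʳ-≃ (ℚᵘ.≃-sym (ℚ.toℚᵘ-fromℚᵘ (ℚᵘ.mkℚᵘ (+ q) n)))
      (ℚᵘ.*≤* (subst₂ ℤ._≤_ (ℤ.pos-* p (suc n)) (ℤ.pos-* q (suc m)) (ℤ.+≤+ h)))))

/-+ : ∀ p q n .{{_ : NonZero n}} → + (p + q) ℚ./ n ≡ + p ℚ./ n ℚ.+ + q ℚ./ n
/-+ p q (suc n) = ℚ.toℚᵘ-injective (begin-equality
  ℚ.toℚᵘ (+ (p + q) ℚ./ suc n)                   ≃⟨ ℚ.toℚᵘ-fromℚᵘ (ℚᵘ.mkℚᵘ (+ (p + q)) n) ⟩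
  ℚᵘ.mkℚᵘ (+ (p + q)) n                          ≃⟨ ℚᵘ.*≡* eq ⟩
  ℚᵘ.mkℚᵘ (+ p) n ℚᵘ.+ ℚᵘ.mkℚᵘ (+ q) n           ≃⟨ ℚᵘ.≃-sym (ℚᵘ.+-cong (ℚ.toℚᵘ-fromℚᵘ (ℚᵘ.mkℚᵘ (+ p) n)) (ℚ.toℚᵘ-fromℚᵘ (ℚᵘ.mkℚᵘ (+ q) n))) ⟩
  ℚ.toℚᵘ (+ p ℚ./ suc n) ℚᵘ.+ ℚ.toℚᵘ (+ q ℚ./ suc n) ≃⟨ ℚᵘ.≃-sym (ℚ.toℚᵘ-homo-+ (+ p ℚ./ suc n) (+ q ℚ./ suc n)) ⟩
  ℚ.toℚᵘ (+ p ℚ./ suc n ℚ.+ + q ℚ./ suc n)       ∎)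
  where
  open ℚᵘ.≤-Reasoning
  d : ℤ
  d = + suc n
  eq : (+ p ℤ.+ + q) ℤ.* (d ℤ.* d) ≡ (+ p ℤ.* d ℤ.+ + q ℤ.* d) ℤ.* d
  eq = trans (sym (ℤ.*-assoc (+ p ℤ.+ + q) d d)) (cong (ℤ._* d) (ℤ.*-distribʳ-+ d (+ p) (+ q)))

log₂-approx-zero : ∀ k → log₂-approx 0 k ≡ 0ℚ
log₂-approx-zero k = ℚ.toℚᵘ-injective
  (ℚᵘ.≃-trans (ℚ.toℚᵘ-fromℚᵘ (ℚᵘ.mkℚᵘ (+ 0) k)) (ℚᵘ.*≡* refl))

log₂-approx-≤ : ∀ a m n → log₂-approx a n ℚ.≤ log₂-approx a m ℚ.+ + 1 ℚ./ suc m
log₂-approx-≤ zero m n = subst₂ ℚ._≤_ (sym (log₂-approx-zero n))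
  (trans (sym (ℚ.+-identityˡ (+ 1 ℚ./ suc m))) (cong (ℚ._+ + 1 ℚ./ suc m) (sym (log₂-approx-zero m))))
  (subst (ℚ._≤ + 1 ℚ./ suc m) (log₂-approx-zero 0) (/-≤ 0 1 1 (suc m) ℕ.z≤n))
log₂-approx-≤ a@(suc _) m n = subst (log₂-approx a n ℚ.≤_) (/-+ f 1 (suc m))
  (/-≤ g (f + 1) (suc n) (suc m) (subst₂ _≤_ (ℕ.*-comm (suc m) g) eq (⌊log₂^⌋-cross a (suc m) (suc n))))
  where
  f = ⌊log₂ (a ^ suc m) ⌋
  g = ⌊log₂ (a ^ suc n) ⌋
  eq : suc n * f + suc n ≡ (f + 1) * suc n
  eq = trans (ℕ.+-comm (suc n * f) (suc n))
         (trans (cong (ℕ._+_ (suc n)) (ℕ.*-comm (suc n) f)) (cong (_* suc n) (ℕ.+-comm 1 f)))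

archimedean : ∀ ε → 0ℚ ℚ.< ε → ∃ λ N → ∀ n → N ≤ n → + 1 ℚ./ suc n ℚ.≤ ε
archimedean ε@(mkℚ (+ suc p) d c) _ = suc d , λ n d<n →
  subst (+ 1 ℚ./ suc n ℚ.≤_) (ℚ.fromℚᵘ-toℚᵘ ε)
    (/-≤ 1 (suc p) (suc n) (suc d)
      (ℕ.≤-trans (ℕ.≤-reflexive (ℕ.*-identityˡ (suc d)))
        (ℕ.≤-trans d<n (ℕ.≤-trans (ℕ.n≤1+n n) (ℕ.m≤m+n (suc n) (p * suc n))))))
archimedean (mkℚ (+ 0) _ _) (ℚ.*<* (ℤ.+<+ ()))
archimedean (mkℚ ℤ.-[1+ _ ] _ _) (ℚ.*<* ())

∣∣-≤ : ∀ p q ε → p ℚ.≤ q ℚ.+ ε → q ℚ.≤ p ℚ.+ ε → ℚ.∣ p ℚ.- q ∣ ℚ.≤ ε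
∣∣-≤ p q ε p≤ q≤ with ℚ.∣p∣≡p∨∣p∣≡-p (p ℚ.- q)
... | inj₁ e = subst₂ ℚ._≤_ (sym e) (cancel q ε) (ℚ.+-monoˡ-≤ (ℚ.- q) p≤)
  where
  cancel : ∀ q ε → (q ℚ.+ ε) ℚ.- q ≡ ε
  cancel = solve 2 (λ q ε → (q :+ ε) :- q := ε) refl
    where open +-*-Solver
... | inj₂ e = subst₂ ℚ._≤_ (trans (flip q p) (sym e)) (cancel p ε) (ℚ.+-monoˡ-≤ (ℚ.- p) q≤)
  where
  open +-*-Solver
  cancel : ∀ q ε → (q ℚ.+ ε) ℚ.- q ≡ ε
  cancel = solve 2 (λ q ε → (q :+ ε) :- q := ε) refl
  flip : ∀ q p → q ℚ.- p ≡ ℚ.- (p ℚ.- q)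
  flip = solve 2 (λ q p → q :- p := :- (p :- q)) refl

abstract
  log₂-isCauchy : ∀ a → IsCauchy (log₂-approx a)
  log₂-isCauchy a ε 0<ε with archimedean ε 0<ε
  ... | N , h = N , λ m n ≤m ≤n → ∣∣-≤ (log₂-approx a m) (log₂-approx a n) ε
    (ℚ.≤-trans (log₂-approx-≤ a n m) (ℚ.+-monoʳ-≤ (log₂-approx a n) (h n ≤n)))
    (ℚ.≤-trans (log₂-approx-≤ a m n) (ℚ.+-monoʳ-≤ (log₂-approx a m) (h m ≤m)))

log₂ : ℕ → ℝ
log₂ a = mkℝ (log₂-approx a) (log₂-isCauchy a)

-- Meaningful for p > 0 only.
log₂ℚ : ℚ → ℝ
log₂ℚ p = log₂ ℤ.∣ ℚ.↥ p ∣ -ᵣ log₂ (ℚ.↧ₙ p)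

-- For 0 ≤ p ≤ 1.  The convention H₂ 0 = H₂ 1 = 0 holds because log₂ℚ 0 is a
-- (finite) real number, here multiplied by 0, and log₂ℚ 1 = 0.
H₂ : ℚ → ℝ
H₂ p = -ᵣ (fromℚ p *ᵣ log₂ℚ p) -ᵣ fromℚ (1ℚ ℚ.- p) *ᵣ log₂ℚ (1ℚ ℚ.- p)

1/ℕ_ : ∀ n .{{_ : NonZero n}} → ℚ
1/ℕ n = + 1 ℚ./ n

1-1/R≢0 : ∀ R .{{_ : NonTrivial R}} →
  ℚ.NonZero (1ℚ ℚ.- (1/ℕ R) {{ℕ.nonTrivial⇒nonZero R}})
1-1/R≢0 R@(suc (suc r)) = ℚ.≢-nonZero {1ℚ ℚ.- p} λ eq →
  ℚ.<⇒≢ 1/R<1 (trans (sym (ℚ.+-identityˡ p)) (trans (cong (λ t → t ℚ.+ p) {0ℚ} {1ℚ ℚ.- p} (sym eq)) (cancel p)))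
  where
  p = 1/ℕ R
  1/R<1 : p ℚ.< 1ℚ
  1/R<1 = ℚ.toℚᵘ-cancel-< (ℚᵘ.<-respˡ-≃ (ℚᵘ.≃-sym (ℚ.toℚᵘ-fromℚᵘ (ℚᵘ.mkℚᵘ (+ 1) (suc r))))
    (ℚᵘ.*<* (ℤ.+<+ (ℕ.s≤s (ℕ.s≤s ℕ.z≤n)))))
  cancel : ∀ p → (1ℚ ℚ.- p) ℚ.+ p ≡ 1ℚ
  cancel = solve 1 (λ p → (con 1ℚ :- p) :+ p := con 1ℚ) refl
    where open +-*-Solver

entropyBound : ∀ R .{{_ : NonTrivial R}} → ℝ
entropyBound R = H₂ p *ᵣ fromℚ ((ℚ.1/ (1ℚ ℚ.- p)) {{1-1/R≢0 R}})
  where p = (1/ℕ R) {{ℕ.nonTrivial⇒nonZero R}}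

-- `running ds Z M` is a call about to test the guard (M mod N) R ≥ M of its
-- digit-reading loop, with ds the source digits not yet read; `returned X Z M`
-- is a finished call with value X and final state (Z , M).
data Config (A : ℕ) : Set where
  running  : (ds : List (Fin A)) (Z M : ℕ) → Config A
  returned : (X Z M : ℕ) → Config A

data Action : Set where
  read accept reject : Action

module Draw (N R A : ℕ) .{{_ : NonZero N}} where

  action : (Z M : ℕ) → Action
  action Z M =
    if does (M ℕ.≤? M % N * R) then read
    else if does (Z ℕ.<? M / N * N) then accept
    else reject

  -- One step either reads one digit or performs one attempted split.  A machine
  -- that has exhausted its digits waits.
  step : Config A → Config A
  step (returned X Z M)   = returned X Z M
  step (running ds Z M) with action Z M
  ... | accept = returned (Z % N) (Z / N) (M / N)
  ... | reject = running ds (M ∸ 1 ∸ Z) (M ∸ M / N * N)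
  step (running []       Z M) | read = running [] Z M
  step (running (d ∷ ds) Z M) | read = running ds (A * Z + toℕ d) (A * M)

  branchLoss : Config A → ℝ
  branchLoss (returned _ _ _)  = fromℚ 0ℚ
  branchLoss (running _ Z M) with action Z M
  ... | read   = fromℚ 0ℚ
  ... | accept = log₂ M -ᵣ log₂ (M / N * N)
  ... | reject = log₂ M -ᵣ log₂ (M ∸ M / N * N)

  lossWithin : ℕ → Config A → ℝ
  lossWithin zero    c = fromℚ 0ℚ
  lossWithin (suc k) c = branchLoss c +ᵣ lossWithin k (step c)

-- The joint law of an initial state (Z , M) and an infinite sequence of source
-- digits U₁ U₂ …, given by its finite-dimensional distributions:
-- pr z m u = P(Z = z, M = m, (U₁, …, U_L) = u) and prM m = P(M = m).
record Law (A : ℕ) : Set where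
  field
    pr         : ∀ {L} → ℕ → ℕ → Vec (Fin A) L → ℝ
    prM        : ℕ → ℝ
    pr-nonNeg  : ∀ {L} z m (u : Vec (Fin A) L) → fromℚ 0ℚ ≤ᵣ pr z m u
    consistent : ∀ {L} z m (u : Vec (Fin A) L) → pr z m u ≃ᵣ ∑ A λ a → pr z m (u ∷ʳ a)
    prM-sum    : ∀ m → SumsTo (λ z → pr z m []) (prM m)
    total      : SumsTo prM (fromℚ 1ℚ)

open Law public

-- Z<M states that P(Z ≥ M) = 0, and `uniform` that P(Z = z | M = m) = 1 / m for
-- z < m, in the form that also makes sense when P(M = m) = 0.
record IsUniformState {A} (μ : Law A) : Set where
  field
    M-positive : prM μ 0 ≃ᵣ fromℚ 0ℚ
    Z<M        : ∀ z m → m ≤ z → pr μ z m [] ≃ᵣ fromℚ 0ℚ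
    uniform    : ∀ z m .{{_ : NonZero m}} → z < m → pr μ z m [] ≃ᵣ prM μ m *ᵣ fromℚ (1/ℕ m)

-- (U₁, …, U_L) is independent of (Z , M) and uniform on [A]^L, for every L;
-- i.e. the digits are mutually independent, uniform on [A], and jointly
-- independent of (Z , M).
IndependentUniformDigits : ∀ {A} .{{_ : NonTrivial A}} → Law A → Set
IndependentUniformDigits {A} μ = ∀ {L} z m (u : Vec (Fin A) L) →
  pr μ z m u ≃ᵣ pr μ z m [] *ᵣ fromℚ ((1/ℕ (A ^ L)) {{ℕ.m^n≢0 A L {{ℕ.nonTrivial⇒nonZero A}}}})

∑words : ∀ {A} L → (Vec (Fin A) L → ℝ) → ℝ
∑words zero    f = f []
∑words (suc L) f = ∑ _ λ a → ∑words L λ u → f (a ∷ u)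

-- A nonnegative random variable X on sequences (Z , M , U₁ , U₂ , …), given as
-- the limit of a nondecreasing sequence of nonnegative X n, where X n depends on
-- the digits only through U₁, …, U_n.
Variable : ℕ → Set
Variable A = ∀ n → (z m : ℕ) → Vec (Fin A) n → ℝ

-- Elements of [0 , ∞], as suprema of nondecreasing sequences of reals.
ℝ∞ : Set
ℝ∞ = ℕ → ℝ

infix 4 _≤∞_
_≤∞_ : ℝ∞ → ℝ → Set
e ≤∞ b = ∀ n → e n ≤ᵣ b

-- E X is the supremum of E[X n ; Z < n , M < n], by monotone convergence.
𝔼 : ∀ {A} → Law A → Variable A → ℝ∞
𝔼 μ X n = ∑< n λ m → ∑< n λ z → ∑words n λ u → pr μ z m u *ᵣ X n z m u

-- The losses of the first n steps of the machine.  As each step reads at most one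
-- digit, n digits suffice for n steps.  Branch losses are nonnegative, so this is
-- nondecreasing in n, with limit the total branch loss of the call.
totalBranchLoss : ∀ N (R A : ℕ) .{{_ : NonZero N}} → Variable A
totalBranchLoss N R A n z m u = lossWithin n (running (toList u) z m)
  where open Draw N R A

-- A split of a modulus m = a + s into a accepted and s rejected values loses on
-- average (a log₂ (m/a) + s log₂ (m/s)) / m, the entropy H of (a/m , s/m).  The
-- guard gives s/m < 1/R, and Gibbs' inequality against (1 - 1/R , 1/R) yields
-- m H ≤ a B with B = H₂(1/R) / (1 - 1/R): the loss is paid for by the accepted
-- values alone.  Reading a digit maps the uniform state on [m] to the uniform
-- state on [A m], and a rejection leaves a uniform state on [s], so by induction
-- on the number of steps the loss summed over all Z < m and all l-digit words is
-- at most m Aˡ B.  Gibbs' inequality becomes an inequality between powers of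
-- natural numbers, which follows from the weighted AM-GM inequality.

{-# OPTIONS --safe #-}
module Submission where

open import Defs
open import Data.Fin as Fin using (Fin; toℕ)
open import Data.Integer as ℤ using (+_)
import Data.Integer.Properties as ℤ
import Data.Integer.GCD as ℤ
open import Data.List using (List; []; _∷_)
open import Data.Nat as ℕ using (ℕ; zero; suc; NonZero; NonTrivial)
import Data.Nat.DivMod as ℕ
open import Data.Nat.Logarithm using (⌊log₂_⌋; ⌊log₂⌋-mono-≤; ⌊log₂[2^n]⌋≡n)
import Data.Nat.Properties as ℕ
import Data.Nat.Solver as ℕ
open import Data.Product using (_×_; _,_; ∃; proj₁; proj₂)
open import Data.Rational as ℚ using (ℚ; 0ℚ; 1ℚ; ½)
import Data.Rational.Properties as ℚ
open import Data.Rational.Solver using (module +-*-Solver)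
open import Data.Sum using (_⊎_; inj₁; inj₂)
open import Data.Vec using (Vec; []; _∷_; toList)
open import Level using (0ℓ)
open import Relation.Binary.Bundles using (Poset)
open import Relation.Binary.PropositionalEquality
  using (_≡_; refl; sym; trans; cong; cong₂; subst; subst₂)
open import Relation.Nullary using (¬_; Dec; yes; no)
open import Relation.Nullary.Decidable using (dec-true; dec-false)

-- Weighted arithmetic and geometric means of natural numbers

module _ where
  open import Data.Nat
  open import Data.Nat.Properties
  open ≤-Reasoning
  open ℕ.+-*-Solver

  -- Ordering the two numbers makes the difference d a natural number; the two sides then differ by
  -- d * d.
  2mn≤m²+n² : ∀ m n → 2 * (m * n) ≤ m * m + n * n
  2mn≤m²+n² m n = cases (≤-total m n)
    where
    ordered : ∀ m n → m ≤ n → 2 * (m * n) ≤ m * m + n * n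
    ordered m n m≤n with n ∸ m | m+[n∸m]≡n m≤n
    ... | d | refl = begin
      2 * (m * (m + d))          ≤⟨ m≤m+n _ (d * d) ⟩
      2 * (m * (m + d)) + d * d  ≡⟨ solve 2 (λ m d → con 2 :* (m :* (m :+ d)) :+ d :* d := m :* m :+ (m :+ d) :* (m :+ d)) refl m d ⟩
      m * m + (m + d) * (m + d)  ∎
    cases : m ≤ n ⊎ n ≤ m → 2 * (m * n) ≤ m * m + n * n
    cases (inj₁ m≤n) = ordered m n m≤n
    cases (inj₂ n≤m) = subst₂ _≤_ (cong (2 *_) (*-comm n m)) (+-comm (n * n) (m * m)) (ordered n m n≤m)

  -- The homogeneous form of Bernoulli's inequality: for x = u / v it reads (n + 1) x ≤ xⁿ⁺¹ + n,
  -- with denominators and differences cleared so that it can be stated in ℕ.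
  bernoulli : ∀ n u v → suc n * (u * v ^ n) ≤ u ^ suc n + n * v ^ suc n
  bernoulli zero    u v = ≤-reflexive (solve 1 (λ u → con 1 :* (u :* con 1) := u :* con 1 :+ con 0) refl u)
  -- The term added to both sides completes the left side to a multiple of 2 u v. After 2 u v ≤ u² +
  -- v², the induction hypothesis multiplied by u applies.
  bernoulli (suc n) u v = +-cancelʳ-≤ (n * (u * (v * w))) _ _ (begin
    suc (suc n) * (u * (v * w)) + n * (u * (v * w))
      ≡⟨ solve 4 (λ n u v w → (con 2 :+ n) :* (u :* (v :* w)) :+ n :* (u :* (v :* w))
           := (con 1 :+ n) :* w :* (con 2 :* (u :* v))) refl n u v w ⟩
    suc n * w * (2 * (u * v))
      ≤⟨ *-monoʳ-≤ (suc n * w) (2mn≤m²+n² u v) ⟩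
    suc n * w * (u * u + v * v)
      ≡⟨ solve 4 (λ n u v w → (con 1 :+ n) :* w :* (u :* u :+ v :* v)
           := u :* ((con 1 :+ n) :* (u :* w)) :+ (con 1 :+ n) :* (v :* (v :* w))) refl n u v w ⟩
    u * (suc n * (u * w)) + suc n * (v * (v * w))
      ≤⟨ +-monoˡ-≤ _ (*-monoʳ-≤ u (bernoulli n u v)) ⟩
    u * (u ^ suc n + n * (v * w)) + suc n * (v * (v * w))
      ≡⟨ solve 5 (λ n u v w p → u :* (p :+ n :* (v :* w)) :+ (con 1 :+ n) :* (v :* (v :* w))
           := (u :* p :+ (con 1 :+ n) :* (v :* (v :* w))) :+ n :* (u :* (v :* w))) refl n u v w (u ^ suc n) ⟩
    (u * u ^ suc n + suc n * (v * (v * w))) + n * (u * (v * w)) ∎)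
    where w = v ^ n

  ^-distribʳ-* : ∀ n x y → (x * y) ^ n ≡ x ^ n * y ^ n
  ^-distribʳ-* zero    x y = refl
  ^-distribʳ-* (suc n) x y = trans (cong (x * y *_) (^-distribʳ-* n x y))
    (solve 4 (λ x y p q → x :* y :* (p :* q) := x :* p :* (y :* q)) refl x y (x ^ n) (y ^ n))

  -- Bernoulli's inequality for the ratio of two successive arithmetic means.
  mean-step : ∀ n S y → suc n ^ suc n * (S ^ n * y) ≤ (S + y) ^ suc n * n ^ n
  mean-step zero      S y = ≤-trans
    (≤-reflexive (solve 1 (λ y → con 1 :* (con 1 :* y) := y) refl y))
    (≤-trans (m≤n+m y S) (≤-reflexive (solve 1 (λ t → t := t :* con 1 :* con 1) refl (S + y))))
  mean-step n@(suc _) S y = *-cancelʳ-≤ _ _ n (+-cancelʳ-≤ (n * (v * v ^ n)) _ _ (begin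
    suc n * suc n ^ n * (S ^ n * y) * n + n * (v * v ^ n)
      ≡⟨ cong (λ t → suc n * suc n ^ n * (S ^ n * y) * n + n * (v * t)) (^-distribʳ-* n (suc n) S) ⟩
    suc n * suc n ^ n * (S ^ n * y) * n + n * (suc n * S * (suc n ^ n * S ^ n))
      ≡⟨ solve 5 (λ n p q S y → (con 1 :+ n) :* p :* (q :* y) :* n :+ n :* ((con 1 :+ n) :* S :* (p :* q))
           := (con 1 :+ n) :* ((S :+ y) :* n :* (p :* q))) refl n (suc n ^ n) (S ^ n) S y ⟩
    suc n * (u * (suc n ^ n * S ^ n))
      ≡⟨ cong (λ t → suc n * (u * t)) (^-distribʳ-* n (suc n) S) ⟨
    suc n * (u * v ^ n)
      ≤⟨ bernoulli n u v ⟩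
    u * u ^ n + n * (v * v ^ n)
      ≡⟨ cong (λ t → u * t + n * (v * v ^ n)) (^-distribʳ-* n (S + y) n) ⟩
    (S + y) * n * ((S + y) ^ n * n ^ n) + n * (v * v ^ n)
      ≡⟨ cong (_+ n * (v * v ^ n)) (solve 4 (λ t n p q → t :* n :* (p :* q) := t :* p :* q :* n) refl (S + y) n ((S + y) ^ n) (n ^ n)) ⟩
    (S + y) * (S + y) ^ n * n ^ n * n + n * (v * v ^ n) ∎))
    where
    u = (S + y) * n
    v = suc n * S

  -- The case n = 0 is 0 ^ 0 = 1, which admits empty weights in the cancellations below.
  n^n≢0 : ∀ n → NonZero (n ^ n)
  n^n≢0 zero      = _
  n^n≢0 n@(suc _) = m^n≢0 n n

  -- AM-GM for a copies of x and s copies of y, raised to the power a + s. Induction on s adjoins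
  -- one copy of y at a time by `mean-step`; with copies of x alone, equality holds.
  weighted-AM-GM : ∀ a s x y → (a + s) ^ (a + s) * (x ^ a * y ^ s) ≤ (a * x + s * y) ^ (a + s)
  weighted-AM-GM a zero    x y rewrite +-identityʳ a | +-identityʳ (a * x) | *-identityʳ (x ^ a) =
    ≤-reflexive (sym (^-distribʳ-* a a x))
  weighted-AM-GM a (suc s) x y rewrite +-suc a s = *-cancelʳ-≤ _ _ (n ^ n) {{n^n≢0 n}} (begin
    suc n ^ suc n * (x ^ a * (y * y ^ s)) * n ^ n
      ≡⟨ solve 5 (λ p q y r t → p :* (q :* (y :* r)) :* t := p :* ((t :* (q :* r)) :* y)) refl
           (suc n ^ suc n) (x ^ a) y (y ^ s) (n ^ n) ⟩
    suc n ^ suc n * (n ^ n * (x ^ a * y ^ s) * y)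
      ≤⟨ *-monoʳ-≤ (suc n ^ suc n) (*-monoˡ-≤ y (weighted-AM-GM a s x y)) ⟩
    suc n ^ suc n * (S ^ n * y)
      ≤⟨ mean-step n S y ⟩
    (S + y) ^ suc n * n ^ n
      ≡⟨ cong (λ t → t ^ suc n * n ^ n) (solve 3 (λ p q y → p :+ q :+ y := p :+ (y :+ q)) refl (a * x) (s * y) y) ⟩
    (a * x + (y + s * y)) ^ suc n * n ^ n ∎)
    where
    n = a + s
    S = a * x + s * y

  -- Gibbs' inequality (nonnegativity of relative entropy) for the distributions
  -- proportional to (a , s) and (r , p): AM-GM at x = s r and y = a p.
  gibbs-^ : ∀ a s r p .{{_ : NonZero a}} →
    (a + s) ^ (a + s) * (r ^ a * p ^ s) ≤ (r + p) ^ (a + s) * (a ^ a * s ^ s)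
  -- Separate because the factor s ^ a cancelled in the other case vanishes at s = 0.
  gibbs-^ a zero      r p rewrite +-identityʳ a | *-identityʳ (r ^ a) | *-identityʳ (a ^ a) = begin
    a ^ a * r ^ a          ≤⟨ *-monoʳ-≤ (a ^ a) (^-monoˡ-≤ a (m≤m+n r p)) ⟩
    a ^ a * (r + p) ^ a    ≡⟨ *-comm (a ^ a) _ ⟩
    (r + p) ^ a * a ^ a    ∎
  -- The factor aˢ sᵃ turns rᵃ pˢ into (s r)ᵃ (a p)ˢ, whose weighted sum a s r + s a p factors as (r
  -- + p) (a s).
  gibbs-^ a s@(suc _) r p = *-cancelʳ-≤ _ _ (a ^ s * s ^ a)
    {{m*n≢0 _ _ {{m^n≢0 a s}} {{m^n≢0 s a}}}} (begin
    n ^ n * (r ^ a * p ^ s) * (a ^ s * s ^ a)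
      ≡⟨ solve 5 (λ t u v w z → t :* (u :* v) :* (w :* z) := t :* ((z :* u) :* (w :* v))) refl
           (n ^ n) (r ^ a) (p ^ s) (a ^ s) (s ^ a) ⟩
    n ^ n * (s ^ a * r ^ a * (a ^ s * p ^ s))
      ≡⟨ cong (n ^ n *_) (cong₂ _*_ (^-distribʳ-* a s r) (^-distribʳ-* s a p)) ⟨
    n ^ n * ((s * r) ^ a * (a * p) ^ s)
      ≤⟨ weighted-AM-GM a s (s * r) (a * p) ⟩
    (a * (s * r) + s * (a * p)) ^ n
      ≡⟨ cong (_^ n) (solve 4 (λ a s r p → a :* (s :* r) :+ s :* (a :* p) := (r :+ p) :* (a :* s)) refl a s r p) ⟩
    ((r + p) * (a * s)) ^ n
      ≡⟨ trans (^-distribʳ-* n (r + p) (a * s)) (cong ((r + p) ^ n *_) (^-distribʳ-* n a s)) ⟩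
    (r + p) ^ n * (a ^ n * s ^ n)
      ≡⟨ cong ((r + p) ^ n *_) (cong₂ _*_ (^-distribˡ-+-* a a s) (^-distribˡ-+-* s a s)) ⟩
    (r + p) ^ n * (a ^ a * a ^ s * (s ^ a * s ^ s))
      ≡⟨ solve 5 (λ t u v w z → t :* (u :* v :* (w :* z)) := t :* (u :* z) :* (v :* w)) refl
           ((r + p) ^ n) (a ^ a) (a ^ s) (s ^ a) (s ^ s) ⟩
    (r + p) ^ n * (a ^ a * s ^ s) * (a ^ s * s ^ a) ∎)
    where n = a + s

-- Cauchy reals as an ordered ring

open +-*-Solver using (solve; con; _:+_; _:*_; _:-_; :-_; _:=_)

infix 4 _≗ᵣ_
-- Termwise equality of the approximating sequences, finer than `_≃ᵣ_`. The operations act termwise,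
-- so ring identities over ℝ reduce to identities over ℚ.
_≗ᵣ_ : ℝ → ℝ → Set
x ≗ᵣ y = ∀ n → seq x n ≡ seq y n

p≤p+ε : ∀ p {ε} → 0ℚ ℚ.< ε → p ℚ.≤ p ℚ.+ ε
p≤p+ε p {ε} 0<ε = subst (ℚ._≤ p ℚ.+ ε) (ℚ.+-identityʳ p) (ℚ.+-monoʳ-≤ p (ℚ.<⇒≤ 0<ε))

pointwise-≤ : ∀ {x y} → (∀ n → seq x n ℚ.≤ seq y n) → x ≤ᵣ y
pointwise-≤ {x} {y} h = mk≤ λ ε 0<ε → 0 , λ n _ → ℚ.≤-trans (h n) (p≤p+ε (seq y n) 0<ε)

pointwise : ∀ {x y} → x ≗ᵣ y → x ≃ᵣ y
pointwise h = pointwise-≤ (λ n → ℚ.≤-reflexive (h n)) , pointwise-≤ (λ n → ℚ.≤-reflexive (sym (h n)))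

≤ᵣ-refl : ∀ {x} → x ≤ᵣ x
≤ᵣ-refl = pointwise-≤ λ _ → ℚ.≤-refl

≤ᵣ-trans : ∀ {x y z} → x ≤ᵣ y → y ≤ᵣ z → x ≤ᵣ z
≤ᵣ-trans {x} {y} {z} (mk≤ p) (mk≤ q) = mk≤ go
  where
  go : ∀ ε → 0ℚ ℚ.< ε → ∃ λ N → ∀ n → N ℕ.≤ n → seq x n ℚ.≤ seq z n ℚ.+ ε
  go ε 0<ε with p (½ ℚ.* ε) (half-pos 0<ε) | q (½ ℚ.* ε) (half-pos 0<ε)
  ... | M , f | N , g = M ℕ.⊔ N , λ n ≤n → ℚ.≤-trans (f n (left ≤n))
    (subst (seq y n ℚ.+ ½ ℚ.* ε ℚ.≤_)
      (trans (ℚ.+-assoc (seq z n) (½ ℚ.* ε) (½ ℚ.* ε)) (cong (seq z n ℚ.+_) (half+half ε)))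
      (ℚ.+-monoˡ-≤ (½ ℚ.* ε) (g n (right ≤n))))
    where open Common M N

≃ᵣ-refl : ∀ {x} → x ≃ᵣ x
≃ᵣ-refl = ≤ᵣ-refl , ≤ᵣ-refl

≃ᵣ-sym : ∀ {x y} → x ≃ᵣ y → y ≃ᵣ x
≃ᵣ-sym (p , q) = q , p

≃ᵣ-trans : ∀ {x y z} → x ≃ᵣ y → y ≃ᵣ z → x ≃ᵣ z
≃ᵣ-trans (p , q) (p′ , q′) = ≤ᵣ-trans p p′ , ≤ᵣ-trans q′ q

ℝ-poset : Poset 0ℓ 0ℓ 0ℓ
ℝ-poset = record
  { Carrier = ℝ ; _≈_ = _≃ᵣ_ ; _≤_ = _≤ᵣ_
  ; isPartialOrder = record
    { isPreorder = record
      { isEquivalence = record { refl = ≃ᵣ-refl ; sym = ≃ᵣ-sym ; trans = ≃ᵣ-trans }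
      ; reflexive = proj₁
      ; trans = ≤ᵣ-trans }
    ; antisym = _,_ } }

open import Relation.Binary.Reasoning.PartialOrder ℝ-poset

+ᵣ-mono-≤ : ∀ {x y z w} → x ≤ᵣ y → z ≤ᵣ w → x +ᵣ z ≤ᵣ y +ᵣ w
+ᵣ-mono-≤ {x} {y} {z} {w} (mk≤ p) (mk≤ q) = mk≤ go
  where
  interchange : ∀ y w h → (y ℚ.+ h) ℚ.+ (w ℚ.+ h) ≡ (y ℚ.+ w) ℚ.+ (h ℚ.+ h)
  interchange = solve 3 (λ y w h → (y :+ h) :+ (w :+ h) := (y :+ w) :+ (h :+ h)) refl
  go : ∀ ε → 0ℚ ℚ.< ε → ∃ λ N → ∀ n → N ℕ.≤ n →
    seq x n ℚ.+ seq z n ℚ.≤ (seq y n ℚ.+ seq w n) ℚ.+ ε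
  go ε 0<ε with p (½ ℚ.* ε) (half-pos 0<ε) | q (½ ℚ.* ε) (half-pos 0<ε)
  ... | M , f | N , g = M ℕ.⊔ N , λ n ≤n →
    subst (seq x n ℚ.+ seq z n ℚ.≤_)
      (trans (interchange (seq y n) (seq w n) (½ ℚ.* ε))
        (cong ((seq y n ℚ.+ seq w n) ℚ.+_) (half+half ε)))
      (ℚ.+-mono-≤ (f n (left ≤n)) (g n (right ≤n)))
    where open Common M N

+ᵣ-cong : ∀ {x y z w} → x ≃ᵣ y → z ≃ᵣ w → x +ᵣ z ≃ᵣ y +ᵣ w
+ᵣ-cong (p , p′) (q , q′) = +ᵣ-mono-≤ p q , +ᵣ-mono-≤ p′ q′

+ᵣ-identityʳ : ∀ x → x +ᵣ fromℚ 0ℚ ≃ᵣ x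
+ᵣ-identityʳ x = pointwise λ n → ℚ.+-identityʳ (seq x n)

+ᵣ-identityˡ : ∀ x → fromℚ 0ℚ +ᵣ x ≃ᵣ x
+ᵣ-identityˡ x = pointwise λ n → ℚ.+-identityˡ (seq x n)

+ᵣ-assoc : ∀ x y z → (x +ᵣ y) +ᵣ z ≃ᵣ x +ᵣ (y +ᵣ z)
+ᵣ-assoc x y z = pointwise λ n → ℚ.+-assoc (seq x n) (seq y n) (seq z n)

+ᵣ-comm : ∀ x y → x +ᵣ y ≃ᵣ y +ᵣ x
+ᵣ-comm x y = pointwise λ n → ℚ.+-comm (seq x n) (seq y n)

+ᵣ-cancelʳ-≤ : ∀ x y z → x +ᵣ z ≤ᵣ y +ᵣ z → x ≤ᵣ y
+ᵣ-cancelʳ-≤ x y z h = begin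
  x                 ≈⟨ pointwise (λ n → cancel (seq x n) (seq z n)) ⟩
  (x +ᵣ z) -ᵣ z     ≤⟨ +ᵣ-mono-≤ h ≤ᵣ-refl ⟩
  (y +ᵣ z) -ᵣ z     ≈⟨ pointwise (λ n → cancel (seq y n) (seq z n)) ⟨
  y                 ∎
  where
  cancel : ∀ x z → x ≡ (x ℚ.+ z) ℚ.- z
  cancel = solve 2 (λ x z → x := (x :+ z) :- z) refl

-ᵣ-antimono-≤ : ∀ {x y} → x ≤ᵣ y → -ᵣ y ≤ᵣ -ᵣ x
-ᵣ-antimono-≤ {x} {y} h = +ᵣ-cancelʳ-≤ (-ᵣ y) (-ᵣ x) (x +ᵣ y) (begin
  -ᵣ y +ᵣ (x +ᵣ y)  ≈⟨ pointwise (λ n → solve 2 (λ x y → :- y :+ (x :+ y) := x) refl (seq x n) (seq y n)) ⟩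
  x                 ≤⟨ h ⟩
  y                 ≈⟨ pointwise (λ n → solve 2 (λ x y → y := :- x :+ (x :+ y)) refl (seq x n) (seq y n)) ⟩
  -ᵣ x +ᵣ (x +ᵣ y)  ∎)

-ᵣ-cong : ∀ {x y} → x ≃ᵣ y → -ᵣ x ≃ᵣ -ᵣ y
-ᵣ-cong (p , q) = -ᵣ-antimono-≤ q , -ᵣ-antimono-≤ p

≤ᵣ⇒0≤- : ∀ {x y} → x ≤ᵣ y → fromℚ 0ℚ ≤ᵣ y -ᵣ x
≤ᵣ⇒0≤- {x} {y} h = begin
  fromℚ 0ℚ  ≈⟨ pointwise (λ n → sym (ℚ.+-inverseʳ (seq x n))) ⟩
  x -ᵣ x    ≤⟨ +ᵣ-mono-≤ h ≤ᵣ-refl ⟩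
  y -ᵣ x    ∎

-- Turns bounds with an arbitrary error, as supplied by `SumsTo`, into exact ones. Half of ε pays
-- for the error in the hypothesis and half for the slack in `_≤ᵣ_` itself.
≤ᵣ-approx : ∀ {x y} → (∀ ε → 0ℚ ℚ.< ε → x ≤ᵣ y +ᵣ fromℚ ε) → x ≤ᵣ y
≤ᵣ-approx {x} {y} h = mk≤ go
  where
  go : ∀ ε → 0ℚ ℚ.< ε → ∃ λ N → ∀ n → N ℕ.≤ n → seq x n ℚ.≤ seq y n ℚ.+ ε
  go ε 0<ε with eventually (h (½ ℚ.* ε) (half-pos 0<ε)) (½ ℚ.* ε) (half-pos 0<ε)
  ... | N , f = N , λ n ≤n → subst (seq x n ℚ.≤_)
    (trans (ℚ.+-assoc (seq y n) (½ ℚ.* ε) (½ ℚ.* ε)) (cong (seq y n ℚ.+_) (half+half ε)))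
    (f n ≤n)

fromℚ-mono-≤ : ∀ {p q} → p ℚ.≤ q → fromℚ p ≤ᵣ fromℚ q
fromℚ-mono-≤ h = pointwise-≤ λ _ → h

-- Multiplication and the order

≤-∣∣ : ∀ p → p ℚ.≤ ℚ.∣ p ∣
≤-∣∣ p with ℚ.≤-total 0ℚ p
... | inj₁ 0≤p = ℚ.≤-reflexive (sym (ℚ.0≤p⇒∣p∣≡p 0≤p))
... | inj₂ p≤0 = ℚ.≤-trans p≤0 (ℚ.0≤∣p∣ p)

-∣∣-≤ : ∀ p → ℚ.- ℚ.∣ p ∣ ℚ.≤ p
-∣∣-≤ p = subst (ℚ.- ℚ.∣ p ∣ ℚ.≤_) (solve 1 (λ p → :- (:- p) := p) refl p)
  (ℚ.neg-antimono-≤ (subst (ℚ.- p ℚ.≤_) (ℚ.∣-p∣≡∣p∣ p) (≤-∣∣ (ℚ.- p))))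

-- The cap at 1 makes the quadratic term of a product estimate at most linear in δ.
scale≤1 : ∀ K ε → 0ℚ ℚ.< K → 0ℚ ℚ.< ε → ∃ λ δ → 0ℚ ℚ.< δ × δ ℚ.≤ 1ℚ × K ℚ.* δ ℚ.≤ ε
scale≤1 K ε 0<K 0<ε with scale K ε 0<K 0<ε
... | η , 0<η , Kη≡ε with ℚ.≤-total η 1ℚ
... | inj₁ η≤1 = η , 0<η , η≤1 , ℚ.≤-reflexive Kη≡ε
... | inj₂ 1≤η = 1ℚ , ℚ.positive⁻¹ 1ℚ , ℚ.≤-refl , ℚ.≤-trans
  (ℚ.*-monoˡ-≤-nonNeg K {{ℚ.nonNegative (ℚ.<⇒≤ 0<K)}} 1≤η) (ℚ.≤-reflexive Kη≡ε)

-- (x + δ)(y + δ) ≥ 0 with δ ≤ 1 and (K + L + 1) δ ≤ ε, where x ≤ K and y ≤ L.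
*-nonNeg-approx : ∀ x y δ ε K L → x ℚ.≤ K → y ℚ.≤ L → 0ℚ ℚ.≤ δ → δ ℚ.≤ 1ℚ →
  (K ℚ.+ L ℚ.+ 1ℚ) ℚ.* δ ℚ.≤ ε → 0ℚ ℚ.≤ x ℚ.+ δ → 0ℚ ℚ.≤ y ℚ.+ δ → 0ℚ ℚ.≤ x ℚ.* y ℚ.+ ε
*-nonNeg-approx x y δ ε K L x≤K y≤L 0≤δ δ≤1 Kδ≤ε 0≤x 0≤y = ℚ.≤-trans
  (subst (ℚ._≤ (x ℚ.+ δ) ℚ.* (y ℚ.+ δ)) (ℚ.*-zeroˡ (y ℚ.+ δ))
    (ℚ.*-monoʳ-≤-nonNeg (y ℚ.+ δ) {{ℚ.nonNegative 0≤y}} 0≤x))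
  (subst (ℚ._≤ x ℚ.* y ℚ.+ ε)
    (solve 3 (λ x y δ → x :* y :+ (x :+ y :+ δ) :* δ := (x :+ δ) :* (y :+ δ)) refl x y δ)
    (ℚ.+-monoʳ-≤ (x ℚ.* y) (ℚ.≤-trans
      (ℚ.*-monoʳ-≤-nonNeg δ {{ℚ.nonNegative 0≤δ}} (ℚ.+-mono-≤ (ℚ.+-mono-≤ x≤K y≤L) δ≤1))
      Kδ≤ε)))

-- The terms of a nonnegative real are only eventually at least -δ, so termwise products may be
-- negative. Boundedness of both sequences makes this error small.
*ᵣ-nonNeg : ∀ {x y} → fromℚ 0ℚ ≤ᵣ x → fromℚ 0ℚ ≤ᵣ y → fromℚ 0ℚ ≤ᵣ x *ᵣ y
*ᵣ-nonNeg {x} {y} 0≤x 0≤y = mk≤ λ ε 0<ε →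
  go ε 0<ε (eventuallyBounded (seq x) (cauchy x)) (eventuallyBounded (seq y) (cauchy y))
  where
  Bounds : (ℕ → ℚ) → Set
  Bounds z = ∃ λ K → ∃ λ N → 0ℚ ℚ.< K × (∀ n → N ℕ.≤ n → ℚ.∣ z n ∣ ℚ.≤ K)
  go : ∀ ε → 0ℚ ℚ.< ε → Bounds (seq x) → Bounds (seq y) →
    ∃ λ N → ∀ n → N ℕ.≤ n → 0ℚ ℚ.≤ seq x n ℚ.* seq y n ℚ.+ ε
  go ε 0<ε (K , Nx , 0<K , bx) (L , Ny , 0<L , by) =
    go′ (scale≤1 (K ℚ.+ L ℚ.+ 1ℚ) ε (ℚ.+-mono-< (ℚ.+-mono-< 0<K 0<L) (ℚ.positive⁻¹ 1ℚ)) 0<ε)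
    where
    go′ : (∃ λ δ → 0ℚ ℚ.< δ × δ ℚ.≤ 1ℚ × (K ℚ.+ L ℚ.+ 1ℚ) ℚ.* δ ℚ.≤ ε) →
      ∃ λ N → ∀ n → N ℕ.≤ n → 0ℚ ℚ.≤ seq x n ℚ.* seq y n ℚ.+ ε
    go′ (δ , 0<δ , δ≤1 , Kδ≤ε) with eventually 0≤x δ 0<δ | eventually 0≤y δ 0<δ
    ... | Mx , hx | My , hy = (Nx ℕ.⊔ Ny) ℕ.⊔ (Mx ℕ.⊔ My) , λ n ≤n →
      *-nonNeg-approx (seq x n) (seq y n) δ ε K L
        (ℚ.≤-trans (≤-∣∣ (seq x n)) (bx n (B.left (A.left ≤n))))
        (ℚ.≤-trans (≤-∣∣ (seq y n)) (by n (B.right (A.left ≤n))))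
        (ℚ.<⇒≤ 0<δ) δ≤1 Kδ≤ε
        (hx n (C.left (A.right ≤n))) (hy n (C.right (A.right ≤n)))
      where
      module A = Common (Nx ℕ.⊔ Ny) (Mx ℕ.⊔ My)
      module B = Common Nx Ny
      module C = Common Mx My

*ᵣ-monoˡ-≤ : ∀ {x y} z → fromℚ 0ℚ ≤ᵣ z → x ≤ᵣ y → z *ᵣ x ≤ᵣ z *ᵣ y
*ᵣ-monoˡ-≤ {x} {y} z 0≤z x≤y = begin
  z *ᵣ x                        ≈⟨ +ᵣ-identityˡ (z *ᵣ x) ⟨
  fromℚ 0ℚ +ᵣ z *ᵣ x            ≤⟨ +ᵣ-mono-≤ (*ᵣ-nonNeg 0≤z (≤ᵣ⇒0≤- x≤y)) ≤ᵣ-refl ⟩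
  z *ᵣ (y -ᵣ x) +ᵣ z *ᵣ x       ≈⟨ pointwise (λ n → solve 3 (λ x y z → z :* (y :- x) :+ z :* x := z :* y) refl (seq x n) (seq y n) (seq z n)) ⟩
  z *ᵣ y                        ∎

*ᵣ-comm : ∀ x y → x *ᵣ y ≃ᵣ y *ᵣ x
*ᵣ-comm x y = pointwise λ n → ℚ.*-comm (seq x n) (seq y n)

*ᵣ-monoʳ-≤ : ∀ {x y} z → fromℚ 0ℚ ≤ᵣ z → x ≤ᵣ y → x *ᵣ z ≤ᵣ y *ᵣ z
*ᵣ-monoʳ-≤ {x} {y} z 0≤z x≤y =
  ≤ᵣ-trans (proj₁ (*ᵣ-comm x z)) (≤ᵣ-trans (*ᵣ-monoˡ-≤ z 0≤z x≤y) (proj₁ (*ᵣ-comm z y)))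

∣∣≤⇒0≤+ : ∀ p K → ℚ.∣ p ∣ ℚ.≤ K → 0ℚ ℚ.≤ p ℚ.+ K
∣∣≤⇒0≤+ p K h = ℚ.≤-trans (ℚ.≤-reflexive (sym (ℚ.+-inverseˡ K)))
  (ℚ.+-monoˡ-≤ K { ℚ.- K } {p} (ℚ.≤-trans (ℚ.neg-antimono-≤ h) (-∣∣-≤ p)))

boundedBelow : ∀ x → ∃ λ K → 0ℚ ℚ.≤ K × fromℚ 0ℚ ≤ᵣ x +ᵣ fromℚ K
boundedBelow x = go (eventuallyBounded (seq x) (cauchy x))
  where
  go : (∃ λ K → ∃ λ N → 0ℚ ℚ.< K × (∀ n → N ℕ.≤ n → ℚ.∣ seq x n ∣ ℚ.≤ K)) →
    ∃ λ K → 0ℚ ℚ.≤ K × fromℚ 0ℚ ≤ᵣ x +ᵣ fromℚ K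
  go (K , N , 0<K , b) = K , ℚ.<⇒≤ 0<K , mk≤ λ ε 0<ε → N , λ n ≤n →
    ℚ.≤-trans (∣∣≤⇒0≤+ (seq x n) K (b n ≤n)) (p≤p+ε (seq x n ℚ.+ K) 0<ε)

-- z + K ≥ 0 for a rational K ≥ 0, so multiplication by z is the difference of
-- two monotone maps.
*ᵣ-congˡ : ∀ {x y} z → x ≃ᵣ y → z *ᵣ x ≃ᵣ z *ᵣ y
*ᵣ-congˡ {x} {y} z e = go (boundedBelow z)
  where
  mono : ∀ w → fromℚ 0ℚ ≤ᵣ w → w *ᵣ x ≃ᵣ w *ᵣ y
  mono w 0≤w = *ᵣ-monoˡ-≤ w 0≤w (proj₁ e) , *ᵣ-monoˡ-≤ w 0≤w (proj₂ e)
  split : ∀ K x → z *ᵣ x ≃ᵣ (z +ᵣ fromℚ K) *ᵣ x -ᵣ fromℚ K *ᵣ x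
  split K x = pointwise λ n → solve 3 (λ x z k → z :* x := (z :+ k) :* x :- k :* x) refl (seq x n) (seq z n) K
  go : (∃ λ K → 0ℚ ℚ.≤ K × fromℚ 0ℚ ≤ᵣ z +ᵣ fromℚ K) → z *ᵣ x ≃ᵣ z *ᵣ y
  go (K , 0≤K , 0≤z+K) = begin-equality
    z *ᵣ x                                ≈⟨ split K x ⟩
    (z +ᵣ fromℚ K) *ᵣ x -ᵣ fromℚ K *ᵣ x   ≈⟨ +ᵣ-cong (mono (z +ᵣ fromℚ K) 0≤z+K) (-ᵣ-cong (mono (fromℚ K) (fromℚ-mono-≤ 0≤K))) ⟩
    (z +ᵣ fromℚ K) *ᵣ y -ᵣ fromℚ K *ᵣ y   ≈⟨ split K y ⟨
    z *ᵣ y                                ∎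

*ᵣ-cong : ∀ {x y z w} → x ≃ᵣ y → z ≃ᵣ w → x *ᵣ z ≃ᵣ y *ᵣ w
*ᵣ-cong {x} {y} {z} {w} p q = ≃ᵣ-trans (*ᵣ-congˡ x q)
  (≃ᵣ-trans (*ᵣ-comm x w) (≃ᵣ-trans (*ᵣ-congˡ w p) (*ᵣ-comm w y)))

-- Natural numbers and fractions as reals

/-≡ : ∀ p q m n .{{_ : NonZero m}} .{{_ : NonZero n}} →
  p ℕ.* n ≡ q ℕ.* m → + p ℚ./ m ≡ + q ℚ./ n
/-≡ p q m n e = ℚ.≤-antisym (/-≤ p q m n (ℕ.≤-reflexive e)) (/-≤ q p n m (ℕ.≤-reflexive (sym e)))

ι : ℕ → ℚ
ι n = + n ℚ./ 1

fromℕ : ℕ → ℝ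
fromℕ n = fromℚ (ι n)

ι-+ : ∀ m n → ι (m ℕ.+ n) ≡ ι m ℚ.+ ι n
ι-+ m n = /-+ m n 1

/≡ι*1/ℕ : ∀ k n .{{_ : NonZero n}} → + k ℚ./ n ≡ ι k ℚ.* 1/ℕ n
/≡ι*1/ℕ zero    n = trans (/-≡ 0 0 n 1 refl) (sym (ℚ.*-zeroˡ (1/ℕ n)))
/≡ι*1/ℕ (suc k) n = trans (/-+ 1 k n) (trans (cong (1/ℕ n ℚ.+_) (/≡ι*1/ℕ k n))
  (trans (solve 2 (λ k p → p :+ k :* p := (con 1ℚ :+ k) :* p) refl (ι k) (1/ℕ n))
    (cong (ℚ._* 1/ℕ n) (sym (ι-+ 1 k)))))

ι*1/ℕ : ∀ n .{{_ : NonZero n}} → ι n ℚ.* 1/ℕ n ≡ 1ℚ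
ι*1/ℕ n = trans (sym (/≡ι*1/ℕ n n)) (/-≡ n 1 n 1 (ℕ.*-comm n 1))

ι-* : ∀ m n → ι (m ℕ.* n) ≡ ι m ℚ.* ι n
ι-* zero    n = sym (ℚ.*-zeroˡ (ι n))
ι-* (suc m) n = trans (ι-+ n (m ℕ.* n)) (trans (cong (ι n ℚ.+_) (ι-* m n))
  (trans (solve 2 (λ m n → n :+ m :* n := (con 1ℚ :+ m) :* n) refl (ι m) (ι n))
    (cong (ℚ._* ι n) (sym (ι-+ 1 m)))))

ι-mono-≤ : ∀ {m n} → m ℕ.≤ n → ι m ℚ.≤ ι n
ι-mono-≤ {m} {n} m≤n = /-≤ m n 1 1 (ℕ.*-monoˡ-≤ 1 m≤n)

fromℕ-nonNeg : ∀ n → fromℚ 0ℚ ≤ᵣ fromℕ n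
fromℕ-nonNeg n = fromℚ-mono-≤ (ι-mono-≤ {0} {n} ℕ.z≤n)

1/ℕ-nonNeg : ∀ n .{{_ : NonZero n}} → fromℚ 0ℚ ≤ᵣ fromℚ (1/ℕ n)
1/ℕ-nonNeg n = fromℚ-mono-≤ (/-≤ 0 1 1 n ℕ.z≤n)

-- Allows inequalities about the entropy bound to be proved after multiplication by R - 1, which
-- clears its denominators.
fromℕ-cancelˡ-≤ : ∀ n .{{_ : NonZero n}} {x y} → fromℕ n *ᵣ x ≤ᵣ fromℕ n *ᵣ y → x ≤ᵣ y
fromℕ-cancelˡ-≤ n {x} {y} h = begin
  x                                ≈⟨ unscale x ⟨
  fromℚ (1/ℕ n) *ᵣ (fromℕ n *ᵣ x)  ≤⟨ *ᵣ-monoˡ-≤ (fromℚ (1/ℕ n)) (1/ℕ-nonNeg n) h ⟩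
  fromℚ (1/ℕ n) *ᵣ (fromℕ n *ᵣ y)  ≈⟨ unscale y ⟩
  y                                ∎
  where
  unscale : ∀ x → fromℚ (1/ℕ n) *ᵣ (fromℕ n *ᵣ x) ≃ᵣ x
  unscale x = pointwise λ k → trans
    (solve 3 (λ p n x → p :* (n :* x) := (n :* p) :* x) refl (1/ℕ n) (ι n) (seq x k))
    (trans (cong (ℚ._* seq x k) (ι*1/ℕ n)) (ℚ.*-identityˡ (seq x k)))

-- Binary logarithms

⌊log₂⌋-*-lower : ∀ a b .{{_ : NonZero a}} .{{_ : NonZero b}} →
  ⌊log₂ a ⌋ ℕ.+ ⌊log₂ b ⌋ ℕ.≤ ⌊log₂ (a ℕ.* b) ⌋
⌊log₂⌋-*-lower a b = subst (ℕ._≤ ⌊log₂ (a ℕ.* b) ⌋) (⌊log₂[2^n]⌋≡n (⌊log₂ a ⌋ ℕ.+ ⌊log₂ b ⌋))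
  (⌊log₂⌋-mono-≤ (subst (ℕ._≤ a ℕ.* b) (sym (ℕ.^-distribˡ-+-* 2 ⌊log₂ a ⌋ ⌊log₂ b ⌋))
    (ℕ.*-mono-≤ (⌊log₂⌋-lower a) (⌊log₂⌋-lower b))))

-- The strict bounds in `⌊log₂⌋-upper` put a b below 2 to the power ⌊log₂ a⌋ + ⌊log₂ b⌋ + 2, so the
-- floors are additive up to an error of 1.
⌊log₂⌋-*-upper : ∀ a b .{{_ : NonZero a}} .{{_ : NonZero b}} →
  ⌊log₂ (a ℕ.* b) ⌋ ℕ.≤ ⌊log₂ a ⌋ ℕ.+ ⌊log₂ b ⌋ ℕ.+ 1
⌊log₂⌋-*-upper a b = ℕ.≮⇒≥ λ lt → ℕ.<⇒≱ (ℕ.*-mono-< (⌊log₂⌋-upper a) (⌊log₂⌋-upper b))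
  (ℕ.≤-trans (ℕ.≤-reflexive (sym (ℕ.^-distribˡ-+-* 2 (suc ⌊log₂ a ⌋) (suc ⌊log₂ b ⌋))))
    (ℕ.≤-trans (ℕ.^-monoʳ-≤ 2 (subst (ℕ._≤ ⌊log₂ (a ℕ.* b) ⌋) (rearrange ⌊log₂ a ⌋ ⌊log₂ b ⌋) lt))
      (⌊log₂⌋-lower (a ℕ.* b) {{ℕ.m*n≢0 a b}})))
  where
  rearrange : ∀ m n → suc (m ℕ.+ n ℕ.+ 1) ≡ suc m ℕ.+ suc n
  rearrange m n = cong suc (trans (ℕ.+-assoc m n 1) (cong (m ℕ.+_) (ℕ.+-comm n 1)))

-- At the powers a ^ (k + 1) and b ^ (k + 1) the floors are additive up to 1, and division by k + 1
-- makes that error tend to 0. The lower bound holds termwise.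
log₂-* : ∀ a b .{{_ : NonZero a}} .{{_ : NonZero b}} → log₂ (a ℕ.* b) ≃ᵣ log₂ a +ᵣ log₂ b
log₂-* a b = mk≤ upper , pointwise-≤ lower
  where
  fa fb fab : ℕ → ℕ
  fa k = ⌊log₂ (a ℕ.^ suc k) ⌋
  fb k = ⌊log₂ (b ℕ.^ suc k) ⌋
  fab k = ⌊log₂ ((a ℕ.* b) ℕ.^ suc k) ⌋
  lower : ∀ k → log₂-approx a k ℚ.+ log₂-approx b k ℚ.≤ log₂-approx (a ℕ.* b) k
  lower k = subst (ℚ._≤ log₂-approx (a ℕ.* b) k) (/-+ (fa k) (fb k) (suc k))
    (/-≤ (fa k ℕ.+ fb k) (fab k) (suc k) (suc k) (ℕ.*-monoˡ-≤ (suc k)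
      (subst (λ t → fa k ℕ.+ fb k ℕ.≤ ⌊log₂ t ⌋) (sym (^-distribʳ-* (suc k) a b))
        (⌊log₂⌋-*-lower (a ℕ.^ suc k) (b ℕ.^ suc k) {{ℕ.m^n≢0 a (suc k)}} {{ℕ.m^n≢0 b (suc k)}}))))
  upper-1/ : ∀ k → log₂-approx (a ℕ.* b) k ℚ.≤ (log₂-approx a k ℚ.+ log₂-approx b k) ℚ.+ + 1 ℚ./ suc k
  upper-1/ k = subst (log₂-approx (a ℕ.* b) k ℚ.≤_)
    (trans (/-+ (fa k ℕ.+ fb k) 1 (suc k)) (cong (ℚ._+ + 1 ℚ./ suc k) (/-+ (fa k) (fb k) (suc k))))
    (/-≤ (fab k) (fa k ℕ.+ fb k ℕ.+ 1) (suc k) (suc k) (ℕ.*-monoˡ-≤ (suc k)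
      (subst (λ t → ⌊log₂ t ⌋ ℕ.≤ fa k ℕ.+ fb k ℕ.+ 1) (sym (^-distribʳ-* (suc k) a b))
        (⌊log₂⌋-*-upper (a ℕ.^ suc k) (b ℕ.^ suc k) {{ℕ.m^n≢0 a (suc k)}} {{ℕ.m^n≢0 b (suc k)}}))))
  upper : ∀ ε → 0ℚ ℚ.< ε → ∃ λ N → ∀ k → N ℕ.≤ k →
    log₂-approx (a ℕ.* b) k ℚ.≤ (log₂-approx a k ℚ.+ log₂-approx b k) ℚ.+ ε
  upper ε 0<ε with archimedean ε 0<ε
  ... | N , h = N , λ k ≤k → ℚ.≤-trans (upper-1/ k)
    (ℚ.+-monoʳ-≤ (log₂-approx a k ℚ.+ log₂-approx b k) (h k ≤k))

log₂-mono-≤ : ∀ {a b} → a ℕ.≤ b → log₂ a ≤ᵣ log₂ b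
log₂-mono-≤ {a} {b} a≤b = pointwise-≤ λ k →
  /-≤ ⌊log₂ (a ℕ.^ suc k) ⌋ ⌊log₂ (b ℕ.^ suc k) ⌋ (suc k) (suc k)
    (ℕ.*-monoˡ-≤ (suc k) (⌊log₂⌋-mono-≤ (ℕ.^-monoˡ-≤ (suc k) a≤b)))

log₂-1 : log₂ 1 ≃ᵣ fromℚ 0ℚ
log₂-1 = pointwise λ k → trans (cong (λ t → + ⌊log₂ t ⌋ ℚ./ suc k) (ℕ.^-zeroˡ (suc k)))
  (/-≡ 0 0 (suc k) 1 refl)

0≤log₂ : ∀ a .{{_ : NonZero a}} → fromℚ 0ℚ ≤ᵣ log₂ a
0≤log₂ a = ≤ᵣ-trans (proj₂ log₂-1) (log₂-mono-≤ (ℕ.>-nonZero⁻¹ a))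

log₂-^ : ∀ a n .{{_ : NonZero a}} → log₂ (a ℕ.^ n) ≃ᵣ fromℕ n *ᵣ log₂ a
log₂-^ a zero    = ≃ᵣ-trans log₂-1 (pointwise λ k → sym (ℚ.*-zeroˡ (seq (log₂ a) k)))
log₂-^ a (suc n) = begin-equality
  log₂ (a ℕ.* a ℕ.^ n)          ≈⟨ log₂-* a (a ℕ.^ n) ⟩
  log₂ a +ᵣ log₂ (a ℕ.^ n)      ≈⟨ +ᵣ-cong ≃ᵣ-refl (log₂-^ a n) ⟩
  log₂ a +ᵣ fromℕ n *ᵣ log₂ a   ≈⟨ pointwise (λ k → trans
      (solve 2 (λ n l → l :+ n :* l := (con 1ℚ :+ n) :* l) refl (ι n) (seq (log₂ a) k))
      (cong (ℚ._* seq (log₂ a) k) (sym (ι-+ 1 n)))) ⟩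
  fromℕ (suc n) *ᵣ log₂ a       ∎
  where
  instance
    a^n≢0 : NonZero (a ℕ.^ n)
    a^n≢0 = ℕ.m^n≢0 a n

-- At n = 0 this is the convention 0 log 0 = 0: the logarithm of 0 ^ 0 = 1 is 0, and the junk value
-- `log₂ 0` is multiplied by 0.
log₂-n^n : ∀ n → log₂ (n ℕ.^ n) ≃ᵣ fromℕ n *ᵣ log₂ n
log₂-n^n zero      = ≃ᵣ-trans log₂-1 (pointwise λ k → sym (ℚ.*-zeroˡ (seq (log₂ 0) k)))
log₂-n^n n@(suc _) = log₂-^ n n

-- `log₂ℚ` reads the reduced numerator and denominator. The common factor g divided out contributes
-- `log₂ g` to both logarithms and cancels.
log₂ℚ-/ : ∀ a b .{{_ : NonZero a}} .{{_ : NonZero b}} → log₂ℚ (+ a ℚ./ b) ≃ᵣ log₂ a -ᵣ log₂ b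
log₂ℚ-/ a b = cancel ℤ.∣ ℚ.↥ p ∣ (ℚ.↧ₙ p) ℤ.∣ ℤ.gcd (+ a) (+ b) ∣ a b
  (trans (sym (ℤ.abs-* (ℚ.↥ p) (ℤ.gcd (+ a) (+ b)))) (cong ℤ.∣_∣ (ℚ.↥-/ (+ a) b)))
  (trans (sym (ℤ.abs-* (ℚ.↧ p) (ℤ.gcd (+ a) (+ b)))) (cong ℤ.∣_∣ (ℚ.↧-/ (+ a) b)))
  where
  p = + a ℚ./ b
  cancel : ∀ u v g a b .{{_ : NonZero a}} .{{_ : NonZero b}} → u ℕ.* g ≡ a → v ℕ.* g ≡ b →
    log₂ u -ᵣ log₂ v ≃ᵣ log₂ a -ᵣ log₂ b
  cancel u v g _ _ refl refl = ≃ᵣ-trans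
    (pointwise λ k → solve 3 (λ u v g → u :- v := (u :+ g) :- (v :+ g)) refl
      (seq (log₂ u) k) (seq (log₂ v) k) (seq (log₂ g) k))
    (≃ᵣ-sym (+ᵣ-cong (log₂-* u g {{ℕ.m*n≢0⇒m≢0 u}} {{ℕ.m*n≢0⇒n≢0 u}})
      (-ᵣ-cong (log₂-* v g {{ℕ.m*n≢0⇒m≢0 v}} {{ℕ.m*n≢0⇒n≢0 v}}))))

-- Entropy

-- The logarithm of `gibbs-^` at r = n and p = 1, the weights of (1 - 1/R , 1/R) for R = n + 1. With
-- m = a + s, the entropy m log₂ m - a log₂ a - s log₂ s is at most the cross entropy m log₂ R - a
-- log₂ n, both scaled by m; negative terms are moved across.
gibbs : ∀ a s n .{{_ : NonZero a}} .{{_ : NonZero n}} →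
  fromℕ (a ℕ.+ s) *ᵣ log₂ (a ℕ.+ s) +ᵣ fromℕ a *ᵣ log₂ n ≤ᵣ
  fromℕ (a ℕ.+ s) *ᵣ log₂ (suc n) +ᵣ (fromℕ a *ᵣ log₂ a +ᵣ fromℕ s *ᵣ log₂ s)
gibbs a s n = begin
  fromℕ m *ᵣ log₂ m +ᵣ fromℕ a *ᵣ log₂ n                ≈⟨ +ᵣ-cong (log₂-n^n m) (log₂-^ n a) ⟨
  log₂ (m ℕ.^ m) +ᵣ log₂ (n ℕ.^ a)                      ≈⟨ log₂-* (m ℕ.^ m) (n ℕ.^ a) ⟨
  log₂ (m ℕ.^ m ℕ.* n ℕ.^ a)                            ≤⟨ log₂-mono-≤ gibbs-1 ⟩
  log₂ (suc n ℕ.^ m ℕ.* (a ℕ.^ a ℕ.* s ℕ.^ s))          ≈⟨ log₂-* (suc n ℕ.^ m) (a ℕ.^ a ℕ.* s ℕ.^ s) ⟩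
  log₂ (suc n ℕ.^ m) +ᵣ log₂ (a ℕ.^ a ℕ.* s ℕ.^ s)      ≈⟨ +ᵣ-cong (log₂-^ (suc n) m)
                                                             (≃ᵣ-trans (log₂-* (a ℕ.^ a) (s ℕ.^ s))
                                                               (+ᵣ-cong (log₂-n^n a) (log₂-n^n s))) ⟩
  fromℕ m *ᵣ log₂ (suc n) +ᵣ (fromℕ a *ᵣ log₂ a +ᵣ fromℕ s *ᵣ log₂ s) ∎
  where
  m = a ℕ.+ s
  instance
    m^m≢0 : NonZero (m ℕ.^ m)
    m^m≢0 = n^n≢0 m
    a^a≢0 : NonZero (a ℕ.^ a)
    a^a≢0 = n^n≢0 a
    s^s≢0 : NonZero (s ℕ.^ s)
    s^s≢0 = n^n≢0 s
    n^a≢0 : NonZero (n ℕ.^ a)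
    n^a≢0 = ℕ.m^n≢0 n a
    [1+n]^m≢0 : NonZero (suc n ℕ.^ m)
    [1+n]^m≢0 = ℕ.m^n≢0 (suc n) m
    a^a*s^s≢0 : NonZero (a ℕ.^ a ℕ.* s ℕ.^ s)
    a^a*s^s≢0 = ℕ.m*n≢0 (a ℕ.^ a) (s ℕ.^ s)
  gibbs-1 : m ℕ.^ m ℕ.* n ℕ.^ a ℕ.≤ suc n ℕ.^ m ℕ.* (a ℕ.^ a ℕ.* s ℕ.^ s)
  gibbs-1 = subst₂ (λ t u → m ℕ.^ m ℕ.* t ℕ.≤ u ℕ.^ m ℕ.* (a ℕ.^ a ℕ.* s ℕ.^ s))
    (trans (cong (n ℕ.^ a ℕ.*_) (ℕ.^-zeroˡ s)) (ℕ.*-identityʳ (n ℕ.^ a))) (ℕ.+-comm n 1)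
    (gibbs-^ a s n 1)

1-1/R≡ : ∀ n → 1ℚ ℚ.- 1/ℕ (suc n) ≡ + n ℚ./ suc n
1-1/R≡ n = trans
  (cong (ℚ._- 1/ℕ (suc n)) (sym (trans (sym (/-+ n 1 (suc n)))
    (/-≡ (n ℕ.+ 1) 1 (suc n) 1 (trans (ℕ.*-identityʳ (n ℕ.+ 1)) (trans (ℕ.+-comm n 1) (sym (ℕ.*-identityˡ (suc n)))))))))
  (solve 2 (λ x y → (x :+ y) :- y := x) refl (+ n ℚ./ suc n) (1/ℕ (suc n)))

-- For R = n + 1, H₂(1/R) = log₂ R - (n/R) log₂ n and 1 - 1/R = n/R, so multiplying the quotient by
-- n leaves no denominator. The later arguments use the bound only through this identity.
entropyBound-scaled : ∀ n .{{_ : NonZero n}} .{{_ : NonTrivial (suc n)}} →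
  fromℕ n *ᵣ entropyBound (suc n) ≃ᵣ fromℕ (suc n) *ᵣ log₂ (suc n) -ᵣ fromℕ n *ᵣ log₂ n
entropyBound-scaled n = begin-equality
  fromℕ n *ᵣ (H₂ p *ᵣ fromℚ q⁻¹)
    ≈⟨ pointwise (λ k → rescale (seq (log₂ℚ p) k) (seq (log₂ℚ q) k)) ⟩
  -ᵣ log₂ℚ p -ᵣ fromℕ n *ᵣ log₂ℚ q
    ≈⟨ +ᵣ-cong (-ᵣ-cong (log₂ℚ-/ 1 R)) (-ᵣ-cong (*ᵣ-congˡ (fromℕ n)
         (subst (λ t → log₂ℚ t ≃ᵣ log₂ n -ᵣ log₂ R) (sym (1-1/R≡ n)) (log₂ℚ-/ n R)))) ⟩
  -ᵣ (log₂ 1 -ᵣ log₂ R) -ᵣ fromℕ n *ᵣ (log₂ n -ᵣ log₂ R)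
    ≈⟨ +ᵣ-cong (-ᵣ-cong (+ᵣ-cong log₂-1 ≃ᵣ-refl)) ≃ᵣ-refl ⟩
  -ᵣ (fromℚ 0ℚ -ᵣ log₂ R) -ᵣ fromℕ n *ᵣ (log₂ n -ᵣ log₂ R)
    ≈⟨ pointwise (λ k → trans
         (solve 3 (λ n l r → :- (con 0ℚ :- r) :- n :* (l :- r) := (con 1ℚ :+ n) :* r :- n :* l) refl
           (ι n) (seq (log₂ n) k) (seq (log₂ R) k))
         (cong (λ t → t ℚ.* seq (log₂ R) k ℚ.- ι n ℚ.* seq (log₂ n) k) (sym (ι-+ 1 n)))) ⟩
  fromℕ R *ᵣ log₂ R -ᵣ fromℕ n *ᵣ log₂ n ∎
  where
  R = suc n
  p q q⁻¹ : ℚ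
  p = 1/ℕ R
  q = 1ℚ ℚ.- p
  q⁻¹ = (ℚ.1/ q) {{1-1/R≢0 R}}
  ιR*q≡ιn : ι R ℚ.* q ≡ ι n
  ιR*q≡ιn = trans (cong (ι R ℚ.*_) (trans (1-1/R≡ n) (/≡ι*1/ℕ n R)))
    (trans (solve 3 (λ r n p → r :* (n :* p) := n :* (r :* p)) refl (ι R) (ι n) p)
      (trans (cong (ι n ℚ.*_) (ι*1/ℕ R)) (ℚ.*-identityʳ (ι n))))
  qq⁻¹≡1 : q ℚ.* q⁻¹ ≡ 1ℚ
  qq⁻¹≡1 = ℚ.*-inverseʳ q {{1-1/R≢0 R}}
  -- Groups R p, R q and q q⁻¹, which the ring solver cannot evaluate; `rescale` replaces them by 1,
  -- n and 1.
  factor : ∀ r p q i a b → (r ℚ.* q) ℚ.* ((ℚ.- (p ℚ.* a) ℚ.- q ℚ.* b) ℚ.* i) ≡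
    (q ℚ.* i) ℚ.* (ℚ.- ((r ℚ.* p) ℚ.* a) ℚ.- (r ℚ.* q) ℚ.* b)
  factor = solve 6 (λ r p q i a b → (r :* q) :* ((:- (p :* a) :- q :* b) :* i) :=
    (q :* i) :* (:- ((r :* p) :* a) :- (r :* q) :* b)) refl
  rescale : ∀ a b → ι n ℚ.* ((ℚ.- (p ℚ.* a) ℚ.- q ℚ.* b) ℚ.* q⁻¹) ≡ ℚ.- a ℚ.- ι n ℚ.* b
  rescale a b = trans (cong (ℚ._* ((ℚ.- (p ℚ.* a) ℚ.- q ℚ.* b) ℚ.* q⁻¹)) (sym ιR*q≡ιn))
    (trans (factor (ι R) p q q⁻¹ a b)
    (trans (cong₂ (λ t u → t ℚ.* (ℚ.- (u ℚ.* a) ℚ.- (ι R ℚ.* q) ℚ.* b)) qq⁻¹≡1 (ι*1/ℕ R))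
    (trans (cong (λ t → 1ℚ ℚ.* (ℚ.- (1ℚ ℚ.* a) ℚ.- t ℚ.* b)) ιR*q≡ιn)
      (solve 3 (λ n a b → con 1ℚ :* (:- (con 1ℚ :* a) :- n :* b) := :- a :- n :* b) refl (ι n) a b))))

-- t log₂ t does not decrease from n to n + 1: first the logarithm is raised, then its coefficient.
scaled-nonNeg : ∀ n B .{{_ : NonZero n}} →
  fromℕ n *ᵣ B ≃ᵣ fromℕ (suc n) *ᵣ log₂ (suc n) -ᵣ fromℕ n *ᵣ log₂ n → fromℚ 0ℚ ≤ᵣ B
scaled-nonNeg n B scaled = fromℕ-cancelˡ-≤ n (begin
  fromℕ n *ᵣ fromℚ 0ℚ                       ≈⟨ pointwise (λ _ → ℚ.*-zeroʳ (ι n)) ⟩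
  fromℚ 0ℚ                                  ≤⟨ ≤ᵣ⇒0≤- (*ᵣ-monoˡ-≤ (fromℕ n) (fromℕ-nonNeg n) (log₂-mono-≤ (ℕ.n≤1+n n))) ⟩
  fromℕ n *ᵣ log₂ R -ᵣ fromℕ n *ᵣ log₂ n    ≤⟨ +ᵣ-mono-≤ (*ᵣ-monoʳ-≤ (log₂ R) (0≤log₂ R) (fromℚ-mono-≤ (ι-mono-≤ (ℕ.n≤1+n n)))) ≤ᵣ-refl ⟩
  fromℕ R *ᵣ log₂ R -ᵣ fromℕ n *ᵣ log₂ n    ≈⟨ scaled ⟨
  fromℕ n *ᵣ B                              ∎)
  where R = suc n

-- All that the loss recursion needs of B besides nonnegativity: the loss of a split, summed over
-- its a + s values, is at most B per accepted value. The rejected values keep their share for later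
-- splits.
SplitBound : ℕ → ℝ → Set
SplitBound R B = ∀ a s .{{_ : NonZero a}} → s ℕ.* R ℕ.≤ a ℕ.+ s →
  fromℕ a *ᵣ (log₂ (a ℕ.+ s) -ᵣ log₂ a) +ᵣ fromℕ s *ᵣ (log₂ (a ℕ.+ s) -ᵣ log₂ s) ≤ᵣ fromℕ a *ᵣ B

-- Gibbs' inequality bounds the entropy of (a , s) / (a + s) by its cross entropy
-- against (1 - 1/R , 1/R), and s (R - 1) ≤ a.
split-loss : ∀ n B .{{_ : NonZero n}} →
  fromℕ n *ᵣ B ≃ᵣ fromℕ (suc n) *ᵣ log₂ (suc n) -ᵣ fromℕ n *ᵣ log₂ n → SplitBound (suc n) B
split-loss n B scaled a s sR≤ = fromℕ-cancelˡ-≤ n (begin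
  fromℕ n *ᵣ (fromℕ a *ᵣ (log₂ m -ᵣ log₂ a) +ᵣ fromℕ s *ᵣ (log₂ m -ᵣ log₂ s))
    ≈⟨ pointwise (λ k → trans (collect (ι n) (ι a) (ι s) (seq (log₂ m) k) (seq (log₂ n) k) (seq (log₂ a) k) (seq (log₂ s) k))
         (cong (λ t → ι n ℚ.* ((t ℚ.* seq (log₂ m) k ℚ.+ ι a ℚ.* seq (log₂ n) k) ℚ.-
           (ι a ℚ.* seq (log₂ n) k ℚ.+ (ι a ℚ.* seq (log₂ a) k ℚ.+ ι s ℚ.* seq (log₂ s) k)))) (sym (ι-+ a s)))) ⟩
  fromℕ n *ᵣ ((fromℕ m *ᵣ log₂ m +ᵣ fromℕ a *ᵣ log₂ n) -ᵣ c)
    ≤⟨ *ᵣ-monoˡ-≤ (fromℕ n) (fromℕ-nonNeg n) (+ᵣ-mono-≤ (gibbs a s n) ≤ᵣ-refl) ⟩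
  fromℕ n *ᵣ ((fromℕ m *ᵣ log₂ R +ᵣ (fromℕ a *ᵣ log₂ a +ᵣ fromℕ s *ᵣ log₂ s)) -ᵣ c)
    ≈⟨ +ᵣ-identityʳ _ ⟨
  fromℕ n *ᵣ ((fromℕ m *ᵣ log₂ R +ᵣ (fromℕ a *ᵣ log₂ a +ᵣ fromℕ s *ᵣ log₂ s)) -ᵣ c) +ᵣ fromℚ 0ℚ
    ≤⟨ +ᵣ-mono-≤ ≤ᵣ-refl (*ᵣ-nonNeg (fromℕ-nonNeg d) (0≤log₂ R)) ⟩
  fromℕ n *ᵣ ((fromℕ m *ᵣ log₂ R +ᵣ (fromℕ a *ᵣ log₂ a +ᵣ fromℕ s *ᵣ log₂ s)) -ᵣ c) +ᵣ fromℕ d *ᵣ log₂ R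
    ≈⟨ pointwise (λ k → exchange (seq (log₂ R) k) (seq (log₂ n) k) (ι a ℚ.* seq (log₂ a) k ℚ.+ ι s ℚ.* seq (log₂ s) k)) ⟩
  fromℕ a *ᵣ (fromℕ R *ᵣ log₂ R -ᵣ fromℕ n *ᵣ log₂ n)
    ≈⟨ *ᵣ-congˡ (fromℕ a) scaled ⟨
  fromℕ a *ᵣ (fromℕ n *ᵣ B)
    ≈⟨ pointwise (λ k → solve 3 (λ a n b → a :* (n :* b) := n :* (a :* b)) refl (ι a) (ι n) (seq B k)) ⟩
  fromℕ n *ᵣ (fromℕ a *ᵣ B) ∎)
  where
  R = suc n
  m = a ℕ.+ s
  -- The summand a log₂ n is added and subtracted so that the left side of `gibbs` appears.
  c = fromℕ a *ᵣ log₂ n +ᵣ (fromℕ a *ᵣ log₂ a +ᵣ fromℕ s *ᵣ log₂ s)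
  sn≤a : s ℕ.* n ℕ.≤ a
  sn≤a = ℕ.+-cancelʳ-≤ s (s ℕ.* n) a
    (subst (ℕ._≤ m) (trans (ℕ.*-suc s n) (ℕ.+-comm s (s ℕ.* n))) sR≤)
  -- The slack in s (R - 1) ≤ a. Adding the nonnegative d log₂ R turns the cross entropy bound into
  -- exactly a times the scaled value of B.
  d = a ℕ.∸ s ℕ.* n
  ιa≡ : ι a ≡ ι s ℚ.* ι n ℚ.+ ι d
  ιa≡ = trans (cong ι (sym (ℕ.m+[n∸m]≡n sn≤a))) (trans (ι-+ (s ℕ.* n) d) (cong (ℚ._+ ι d) (ι-* s n)))
  collect : ∀ n a s lm ln la ls →
    n ℚ.* (a ℚ.* (lm ℚ.- la) ℚ.+ s ℚ.* (lm ℚ.- ls)) ≡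
    n ℚ.* (((a ℚ.+ s) ℚ.* lm ℚ.+ a ℚ.* ln) ℚ.- (a ℚ.* ln ℚ.+ (a ℚ.* la ℚ.+ s ℚ.* ls)))
  collect = solve 7 (λ n a s lm ln la ls →
    n :* (a :* (lm :- la) :+ s :* (lm :- ls)) :=
    n :* (((a :+ s) :* lm :+ a :* ln) :- (a :* ln :+ (a :* la :+ s :* ls)))) refl
  exchange′ : ∀ n s d lR ln e → let a = s ℚ.* n ℚ.+ d in
    n ℚ.* (((a ℚ.+ s) ℚ.* lR ℚ.+ e) ℚ.- (a ℚ.* ln ℚ.+ e)) ℚ.+ d ℚ.* lR ≡
    a ℚ.* ((1ℚ ℚ.+ n) ℚ.* lR ℚ.- n ℚ.* ln)
  exchange′ = solve 6 (λ n s d lR ln e →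
    n :* ((((s :* n :+ d) :+ s) :* lR :+ e) :- ((s :* n :+ d) :* ln :+ e)) :+ d :* lR :=
    (s :* n :+ d) :* ((con 1ℚ :+ n) :* lR :- n :* ln)) refl
  exchange : ∀ lR ln e →
    ι n ℚ.* ((ι m ℚ.* lR ℚ.+ e) ℚ.- (ι a ℚ.* ln ℚ.+ e)) ℚ.+ ι d ℚ.* lR ≡
    ι a ℚ.* (ι R ℚ.* lR ℚ.- ι n ℚ.* ln)
  exchange lR ln e = trans
    (cong (λ t → ι n ℚ.* ((t ℚ.* lR ℚ.+ e) ℚ.- (ι a ℚ.* ln ℚ.+ e)) ℚ.+ ι d ℚ.* lR) (ι-+ a s))
    (trans (subst (λ a → ι n ℚ.* (((a ℚ.+ ι s) ℚ.* lR ℚ.+ e) ℚ.- (a ℚ.* ln ℚ.+ e)) ℚ.+ ι d ℚ.* lR ≡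
        a ℚ.* ((1ℚ ℚ.+ ι n) ℚ.* lR ℚ.- ι n ℚ.* ln)) (sym ιa≡) (exchange′ (ι n) (ι s) (ι d) lR ln e))
      (cong (λ t → ι a ℚ.* (t ℚ.* lR ℚ.- ι n ℚ.* ln)) (sym (ι-+ 1 n))))

-- Finite sums

≡⇒≃ᵣ : ∀ {x y} → x ≡ y → x ≃ᵣ y
≡⇒≃ᵣ refl = ≃ᵣ-refl

+ᵣ-interchange : ∀ x y z w → (x +ᵣ y) +ᵣ (z +ᵣ w) ≃ᵣ (x +ᵣ z) +ᵣ (y +ᵣ w)
+ᵣ-interchange x y z w = pointwise λ k →
  solve 4 (λ x y z w → (x :+ y) :+ (z :+ w) := (x :+ z) :+ (y :+ w)) refl (seq x k) (seq y k) (seq z k) (seq w k)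

*ᵣ-distribˡ-+ᵣ : ∀ x y z → x *ᵣ (y +ᵣ z) ≃ᵣ x *ᵣ y +ᵣ x *ᵣ z
*ᵣ-distribˡ-+ᵣ x y z = pointwise λ k → ℚ.*-distribˡ-+ (seq x k) (seq y k) (seq z k)

*ᵣ-zeroʳ : ∀ x → x *ᵣ fromℚ 0ℚ ≃ᵣ fromℚ 0ℚ
*ᵣ-zeroʳ x = pointwise λ k → ℚ.*-zeroʳ (seq x k)

*ᵣ-zeroˡ : ∀ x → fromℚ 0ℚ *ᵣ x ≃ᵣ fromℚ 0ℚ
*ᵣ-zeroˡ x = pointwise λ k → ℚ.*-zeroˡ (seq x k)

*ᵣ-identityˡ : ∀ x → fromℚ 1ℚ *ᵣ x ≃ᵣ x
*ᵣ-identityˡ x = pointwise λ k → ℚ.*-identityˡ (seq x k)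

fromℕ-+-* : ∀ m n x → fromℕ (m ℕ.+ n) *ᵣ x ≃ᵣ fromℕ m *ᵣ x +ᵣ fromℕ n *ᵣ x
fromℕ-+-* m n x = pointwise λ k → trans (cong (ℚ._* seq x k) (ι-+ m n))
  (ℚ.*-distribʳ-+ (seq x k) (ι m) (ι n))

fromℕ-*-* : ∀ m n x → fromℕ (m ℕ.* n) *ᵣ x ≃ᵣ fromℕ m *ᵣ (fromℕ n *ᵣ x)
fromℕ-*-* m n x = pointwise λ k → trans (cong (ℚ._* seq x k) (ι-* m n))
  (ℚ.*-assoc (ι m) (ι n) (seq x k))

fromℕ-suc-* : ∀ n x → x +ᵣ fromℕ n *ᵣ x ≃ᵣ fromℕ (suc n) *ᵣ x
fromℕ-suc-* n x = ≃ᵣ-trans (+ᵣ-cong (≃ᵣ-sym (*ᵣ-identityˡ x)) ≃ᵣ-refl) (≃ᵣ-sym (fromℕ-+-* 1 n x))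

∑-cong : ∀ n {f g : Fin n → ℝ} → (∀ i → f i ≃ᵣ g i) → ∑ n f ≃ᵣ ∑ n g
∑-cong zero    h = ≃ᵣ-refl
∑-cong (suc n) h = +ᵣ-cong (h Fin.zero) (∑-cong n λ i → h (Fin.suc i))

∑-+ : ∀ n (f g : Fin n → ℝ) → ∑ n (λ i → f i +ᵣ g i) ≃ᵣ ∑ n f +ᵣ ∑ n g
∑-+ zero    f g = ≃ᵣ-sym (+ᵣ-identityʳ (fromℚ 0ℚ))
∑-+ (suc n) f g = ≃ᵣ-trans (+ᵣ-cong ≃ᵣ-refl (∑-+ n (λ i → f (Fin.suc i)) (λ i → g (Fin.suc i))))
  (+ᵣ-interchange _ _ _ _)

∑-const : ∀ n x → ∑ n (λ _ → x) ≃ᵣ fromℕ n *ᵣ x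
∑-const zero    x = ≃ᵣ-sym (*ᵣ-zeroˡ x)
∑-const (suc n) x = ≃ᵣ-trans (+ᵣ-cong ≃ᵣ-refl (∑-const n x)) (fromℕ-suc-* n x)

∑-*ˡ : ∀ n c (f : Fin n → ℝ) → ∑ n (λ i → c *ᵣ f i) ≃ᵣ c *ᵣ ∑ n f
∑-*ˡ zero    c f = ≃ᵣ-sym (*ᵣ-zeroʳ c)
∑-*ˡ (suc n) c f = ≃ᵣ-trans (+ᵣ-cong ≃ᵣ-refl (∑-*ˡ n c λ i → f (Fin.suc i)))
  (≃ᵣ-sym (*ᵣ-distribˡ-+ᵣ c (f Fin.zero) (∑ n λ i → f (Fin.suc i))))

∑<-mono-≤ : ∀ n {f g : ℕ → ℝ} → (∀ i → i ℕ.< n → f i ≤ᵣ g i) → ∑< n f ≤ᵣ ∑< n g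
∑<-mono-≤ zero    h = ≤ᵣ-refl
∑<-mono-≤ (suc n) h = +ᵣ-mono-≤ (h 0 (ℕ.s≤s ℕ.z≤n)) (∑<-mono-≤ n λ i i<n → h (suc i) (ℕ.s≤s i<n))

∑<-cong : ∀ n {f g : ℕ → ℝ} → (∀ i → i ℕ.< n → f i ≃ᵣ g i) → ∑< n f ≃ᵣ ∑< n g
∑<-cong n h = ∑<-mono-≤ n (λ i i<n → proj₁ (h i i<n)) , ∑<-mono-≤ n (λ i i<n → proj₂ (h i i<n))

∑<-zero : ∀ n {f : ℕ → ℝ} → (∀ i → i ℕ.< n → f i ≃ᵣ fromℚ 0ℚ) → ∑< n f ≃ᵣ fromℚ 0ℚ
∑<-zero n h = ≃ᵣ-trans (∑<-cong n h) (≃ᵣ-trans (∑-const n (fromℚ 0ℚ)) (*ᵣ-zeroʳ (fromℕ n)))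

∑<-nonNeg : ∀ n {f : ℕ → ℝ} → (∀ i → fromℚ 0ℚ ≤ᵣ f i) → fromℚ 0ℚ ≤ᵣ ∑< n f
∑<-nonNeg n {f} h = begin
  fromℚ 0ℚ                ≈⟨ ∑<-zero n (λ _ _ → ≃ᵣ-refl) ⟨
  ∑< n (λ _ → fromℚ 0ℚ)   ≤⟨ ∑<-mono-≤ n (λ i _ → h i) ⟩
  ∑< n f                  ∎

∑<-++ : ∀ m n (f : ℕ → ℝ) → ∑< (m ℕ.+ n) f ≃ᵣ ∑< m f +ᵣ ∑< n (λ i → f (m ℕ.+ i))
∑<-++ zero    n f = ≃ᵣ-sym (+ᵣ-identityˡ (∑< n f))
∑<-++ (suc m) n f = ≃ᵣ-trans (+ᵣ-cong ≃ᵣ-refl (∑<-++ m n λ i → f (suc i)))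
  (≃ᵣ-sym (+ᵣ-assoc (f 0) (∑< m λ i → f (suc i)) (∑< n λ i → f (suc m ℕ.+ i))))

∑<-suc : ∀ n (f : ℕ → ℝ) → ∑< (suc n) f ≃ᵣ ∑< n f +ᵣ f n
∑<-suc zero    f = +ᵣ-comm (f 0) (fromℚ 0ℚ)
∑<-suc (suc n) f = ≃ᵣ-trans (+ᵣ-cong ≃ᵣ-refl (∑<-suc n λ i → f (suc i)))
  (≃ᵣ-sym (+ᵣ-assoc (f 0) (∑< n λ i → f (suc i)) (f (suc n))))

-- The reflection by which a rejection renumbers the values it keeps.
∑<-reverse : ∀ n (f : ℕ → ℝ) → ∑< n (λ i → f (n ℕ.∸ 1 ℕ.∸ i)) ≃ᵣ ∑< n f
∑<-reverse zero    f = ≃ᵣ-refl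
∑<-reverse (suc n) f = begin-equality
  f n +ᵣ ∑< n (λ i → f (n ℕ.∸ suc i))     ≈⟨ +ᵣ-cong ≃ᵣ-refl (∑<-cong n λ i _ → ≡⇒≃ᵣ (cong f (sym (ℕ.∸-+-assoc n 1 i)))) ⟩
  f n +ᵣ ∑< n (λ i → f (n ℕ.∸ 1 ℕ.∸ i))   ≈⟨ +ᵣ-cong ≃ᵣ-refl (∑<-reverse n f) ⟩
  f n +ᵣ ∑< n f                           ≈⟨ +ᵣ-comm (f n) (∑< n f) ⟩
  ∑< n f +ᵣ f n                           ≈⟨ ∑<-suc n f ⟨
  ∑< (suc n) f                            ∎

-- (z , d) ↦ A z + d is a bijection from [m] × [A] to [A m]. In summed form, reading a uniform digit
-- keeps the state uniform.
∑<-digits : ∀ A m (f : ℕ → ℝ) →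
  ∑< m (λ z → ∑ A λ d → f (A ℕ.* z ℕ.+ toℕ d)) ≃ᵣ ∑< (A ℕ.* m) f
∑<-digits A zero    f = ≡⇒≃ᵣ (cong (λ t → ∑< t f) (sym (ℕ.*-zeroʳ A)))
∑<-digits A (suc m) f = begin-equality
  ∑ A (λ d → f (A ℕ.* 0 ℕ.+ toℕ d)) +ᵣ ∑< m (λ z → ∑ A λ d → f (A ℕ.* suc z ℕ.+ toℕ d))
    ≈⟨ +ᵣ-cong
         (∑-cong A λ d → ≡⇒≃ᵣ (cong (λ t → f (t ℕ.+ toℕ d)) (ℕ.*-zeroʳ A)))
         (∑<-cong m λ z _ → ∑-cong A λ d → ≡⇒≃ᵣ (cong f (trans
           (cong (ℕ._+ toℕ d) (ℕ.*-suc A z)) (ℕ.+-assoc A (A ℕ.* z) (toℕ d))))) ⟩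
  ∑< A f +ᵣ ∑< m (λ z → ∑ A λ d → f (A ℕ.+ (A ℕ.* z ℕ.+ toℕ d)))
    ≈⟨ +ᵣ-cong ≃ᵣ-refl (∑<-digits A m λ i → f (A ℕ.+ i)) ⟩
  ∑< A f +ᵣ ∑< (A ℕ.* m) (λ i → f (A ℕ.+ i))
    ≈⟨ ∑<-++ A (A ℕ.* m) f ⟨
  ∑< (A ℕ.+ A ℕ.* m) f
    ≈⟨ ≡⇒≃ᵣ (cong (λ t → ∑< t f) (ℕ.*-suc A m)) ⟨
  ∑< (A ℕ.* suc m) f ∎

∑words-cong : ∀ {A} l {f g : Vec (Fin A) l → ℝ} → (∀ u → f u ≃ᵣ g u) → ∑words l f ≃ᵣ ∑words l g
∑words-cong zero    h = h []
∑words-cong (suc l) h = ∑-cong _ λ a → ∑words-cong l λ u → h (a ∷ u)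

∑words-+ : ∀ {A} l (f g : Vec (Fin A) l → ℝ) →
  ∑words l (λ u → f u +ᵣ g u) ≃ᵣ ∑words l f +ᵣ ∑words l g
∑words-+     zero    f g = ≃ᵣ-refl
∑words-+ {A} (suc l) f g = ≃ᵣ-trans
  (∑-cong A λ a → ∑words-+ l (λ u → f (a ∷ u)) (λ u → g (a ∷ u)))
  (∑-+ A (λ a → ∑words l λ u → f (a ∷ u)) (λ a → ∑words l λ u → g (a ∷ u)))

∑words-const : ∀ {A} l x → ∑words {A} l (λ _ → x) ≃ᵣ fromℕ (A ℕ.^ l) *ᵣ x
∑words-const     zero    x = ≃ᵣ-sym (*ᵣ-identityˡ x)
∑words-const {A} (suc l) x = ≃ᵣ-trans (∑-cong A λ _ → ∑words-const {A} l x)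
  (≃ᵣ-trans (∑-const A (fromℕ (A ℕ.^ l) *ᵣ x)) (≃ᵣ-sym (fromℕ-*-* A (A ℕ.^ l) x)))

∑words-*ˡ : ∀ {A} l c (f : Vec (Fin A) l → ℝ) → ∑words l (λ u → c *ᵣ f u) ≃ᵣ c *ᵣ ∑words l f
∑words-*ˡ     zero    c f = ≃ᵣ-refl
∑words-*ˡ {A} (suc l) c f = ≃ᵣ-trans (∑-cong A λ a → ∑words-*ˡ l c λ u → f (a ∷ u))
  (∑-*ˡ A c λ a → ∑words l λ u → f (a ∷ u))

-- The total loss of a call, summed over all states of modulus M and all digits

module _ (N R A : ℕ) .{{_ : NonZero N}} where
  open Draw N R A

  -- Transitions of the machine, by action

  action-read : ∀ z m → m ℕ.≤ m ℕ.% N ℕ.* R → action z m ≡ read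
  action-read z m h rewrite dec-true (m ℕ.≤? m ℕ.% N ℕ.* R) h = refl

  action-accept : ∀ z m → ¬ m ℕ.≤ m ℕ.% N ℕ.* R → z ℕ.< m ℕ./ N ℕ.* N → action z m ≡ accept
  action-accept z m h z<
    rewrite dec-false (m ℕ.≤? m ℕ.% N ℕ.* R) h | dec-true (z ℕ.<? m ℕ./ N ℕ.* N) z< = refl

  action-reject : ∀ z m → ¬ m ℕ.≤ m ℕ.% N ℕ.* R → ¬ z ℕ.< m ℕ./ N ℕ.* N → action z m ≡ reject
  action-reject z m h z≮
    rewrite dec-false (m ℕ.≤? m ℕ.% N ℕ.* R) h | dec-false (z ℕ.<? m ℕ./ N ℕ.* N) z≮ = refl

  lossWithin-returned : ∀ k x z m → lossWithin k (returned x z m) ≃ᵣ fromℚ 0ℚ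
  lossWithin-returned zero    x z m = ≃ᵣ-refl
  lossWithin-returned (suc k) x z m =
    ≃ᵣ-trans (+ᵣ-identityˡ (lossWithin k (returned x z m))) (lossWithin-returned k x z m)

  -- `branchLossOf` and `stepOf` restate `branchLoss` and `step` with the action as an argument, so
  -- that a known action can be substituted by `cong`.
  branchLossOf : Action → ℕ → ℕ → ℝ
  branchLossOf read   z m = fromℚ 0ℚ
  branchLossOf accept z m = log₂ m -ᵣ log₂ (m ℕ./ N ℕ.* N)
  branchLossOf reject z m = log₂ m -ᵣ log₂ (m ℕ.∸ m ℕ./ N ℕ.* N)

  stepOf : Action → List (Fin A) → ℕ → ℕ → Config A
  stepOf accept ds       z m = returned (z ℕ.% N) (z ℕ./ N) (m ℕ./ N)
  stepOf reject ds       z m = running ds (m ℕ.∸ 1 ℕ.∸ z) (m ℕ.∸ m ℕ./ N ℕ.* N)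
  stepOf read   []       z m = running [] z m
  stepOf read   (d ∷ ds) z m = running ds (A ℕ.* z ℕ.+ toℕ d) (A ℕ.* m)

  branchLoss≡ : ∀ ds z m → branchLoss (running ds z m) ≡ branchLossOf (action z m) z m
  branchLoss≡ ds z m with action z m
  ... | read   = refl
  ... | accept = refl
  ... | reject = refl

  step≡ : ∀ ds z m → step (running ds z m) ≡ stepOf (action z m) ds z m
  step≡ []       z m with action z m
  ... | read   = refl
  ... | accept = refl
  ... | reject = refl
  step≡ (d ∷ ds) z m with action z m
  ... | read   = refl
  ... | accept = refl
  ... | reject = refl

  lossWithin-suc : ∀ k ds z m {α} → action z m ≡ α →
    lossWithin (suc k) (running ds z m) ≡ branchLossOf α z m +ᵣ lossWithin k (stepOf α ds z m)
  lossWithin-suc k ds z m e = cong₂ (λ x c → x +ᵣ lossWithin k c)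
    (trans (branchLoss≡ ds z m) (cong (λ α → branchLossOf α z m) e))
    (trans (step≡ ds z m) (cong (λ α → stepOf α ds z m) e))

  lossWithin-wait : ∀ k z m → action z m ≡ read →
    lossWithin (suc k) (running [] z m) ≃ᵣ lossWithin k (running [] z m)
  lossWithin-wait k z m e =
    ≃ᵣ-trans (≡⇒≃ᵣ (lossWithin-suc k [] z m e)) (+ᵣ-identityˡ (lossWithin k (running [] z m)))

  lossWithin-read : ∀ k d ds z m → action z m ≡ read →
    lossWithin (suc k) (running (d ∷ ds) z m) ≃ᵣ lossWithin k (running ds (A ℕ.* z ℕ.+ toℕ d) (A ℕ.* m))
  lossWithin-read k d ds z m e = ≃ᵣ-trans (≡⇒≃ᵣ (lossWithin-suc k (d ∷ ds) z m e))
    (+ᵣ-identityˡ (lossWithin k (running ds (A ℕ.* z ℕ.+ toℕ d) (A ℕ.* m))))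

  lossWithin-accept : ∀ k ds z m → action z m ≡ accept →
    lossWithin (suc k) (running ds z m) ≃ᵣ log₂ m -ᵣ log₂ (m ℕ./ N ℕ.* N)
  lossWithin-accept k ds z m e = ≃ᵣ-trans (≡⇒≃ᵣ (lossWithin-suc k ds z m e))
    (≃ᵣ-trans (+ᵣ-cong (≃ᵣ-refl {c}) (lossWithin-returned k (z ℕ.% N) (z ℕ./ N) (m ℕ./ N)))
      (+ᵣ-identityʳ c))
    where c = log₂ m -ᵣ log₂ (m ℕ./ N ℕ.* N)

  lossWithin-reject : ∀ k ds z m → action z m ≡ reject → let s = m ℕ.∸ m ℕ./ N ℕ.* N in
    lossWithin (suc k) (running ds z m) ≃ᵣ
    (log₂ m -ᵣ log₂ s) +ᵣ lossWithin k (running ds (m ℕ.∸ 1 ℕ.∸ z) s)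
  lossWithin-reject k ds z m e = ≡⇒≃ᵣ (lossWithin-suc k ds z m e)

  -- Losses summed over words and states

  accepted rejected : ℕ → ℕ
  accepted m = m ℕ./ N ℕ.* N
  rejected m = m ℕ.∸ accepted m

  accepted+rejected : ∀ m → accepted m ℕ.+ rejected m ≡ m
  accepted+rejected m = ℕ.m+[n∸m]≡n (ℕ.m/n*n≤m m N)

  -- An expectation without its normalising factor 1/Aˡ. The steps k and the available digits l are
  -- counted separately because a split takes a step but no digit.
  wordLoss : ℕ → ℕ → ℕ → ℕ → ℝ
  wordLoss k l z m = ∑words l λ u → lossWithin k (running (toList u) z m)

  modulusLoss : ℕ → ℕ → ℕ → ℝ
  modulusLoss k l m = ∑< m λ z → wordLoss k l z m

  wordLoss-accept : ∀ k l z m → ¬ m ℕ.≤ m ℕ.% N ℕ.* R → z ℕ.< accepted m →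
    wordLoss (suc k) l z m ≃ᵣ fromℕ (A ℕ.^ l) *ᵣ (log₂ m -ᵣ log₂ (accepted m))
  wordLoss-accept k l z m h z< = ≃ᵣ-trans
    (∑words-cong l λ u → lossWithin-accept k (toList u) z m (action-accept z m h z<))
    (∑words-const {A} l (log₂ m -ᵣ log₂ (accepted m)))

  wordLoss-reject : ∀ k l z m → ¬ m ℕ.≤ m ℕ.% N ℕ.* R → ¬ z ℕ.< accepted m →
    wordLoss (suc k) l z m ≃ᵣ
    fromℕ (A ℕ.^ l) *ᵣ (log₂ m -ᵣ log₂ (rejected m)) +ᵣ wordLoss k l (m ℕ.∸ 1 ℕ.∸ z) (rejected m)
  wordLoss-reject k l z m h z≮ = begin-equality
    wordLoss (suc k) l z m
      ≈⟨ ∑words-cong l (λ u → lossWithin-reject k (toList u) z m (action-reject z m h z≮)) ⟩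
    ∑words l (λ u → c +ᵣ lossWithin k (running (toList u) z′ (rejected m)))
      ≈⟨ ∑words-+ l (λ _ → c) (λ u → lossWithin k (running (toList u) z′ (rejected m))) ⟩
    ∑words {A} l (λ _ → c) +ᵣ wordLoss k l z′ (rejected m)
      ≈⟨ +ᵣ-cong (∑words-const {A} l c) ≃ᵣ-refl ⟩
    fromℕ (A ℕ.^ l) *ᵣ c +ᵣ wordLoss k l z′ (rejected m) ∎
    where
    z′ = m ℕ.∸ 1 ℕ.∸ z
    c = log₂ m -ᵣ log₂ (rejected m)

  modulusLoss-wait : ∀ k m → m ℕ.≤ m ℕ.% N ℕ.* R → modulusLoss (suc k) 0 m ≃ᵣ modulusLoss k 0 m
  modulusLoss-wait k m h = ∑<-cong m λ z _ → lossWithin-wait k z m (action-read z m h)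

  modulusLoss-read : ∀ k l m → m ℕ.≤ m ℕ.% N ℕ.* R →
    modulusLoss (suc k) (suc l) m ≃ᵣ modulusLoss k l (A ℕ.* m)
  modulusLoss-read k l m h = ≃ᵣ-trans
    (∑<-cong m λ z _ → ∑-cong A λ d → ∑words-cong l λ u →
      lossWithin-read k d (toList u) z m (action-read z m h))
    (∑<-digits A m λ z → wordLoss k l z (A ℕ.* m))

  splitLoss : ℕ → ℝ
  splitLoss m = fromℕ (accepted m) *ᵣ (log₂ m -ᵣ log₂ (accepted m)) +ᵣ
    fromℕ (rejected m) *ᵣ (log₂ m -ᵣ log₂ (rejected m))

  -- The rejected z are accepted m + i for i < rejected m, sent to rejected m - 1 - i.
  modulusLoss-split : ∀ k l m → ¬ m ℕ.≤ m ℕ.% N ℕ.* R →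
    modulusLoss (suc k) l m ≃ᵣ fromℕ (A ℕ.^ l) *ᵣ splitLoss m +ᵣ modulusLoss k l (rejected m)
  modulusLoss-split k l m h = begin-equality
    modulusLoss (suc k) l m
      ≈⟨ ≡⇒≃ᵣ (cong (λ t → ∑< t λ z → wordLoss (suc k) l z m) (sym (accepted+rejected m))) ⟩
    ∑< (accepted m ℕ.+ rejected m) (λ z → wordLoss (suc k) l z m)
      ≈⟨ ∑<-++ (accepted m) (rejected m) (λ z → wordLoss (suc k) l z m) ⟩
    ∑< (accepted m) (λ z → wordLoss (suc k) l z m) +ᵣ
    ∑< (rejected m) (λ i → wordLoss (suc k) l (accepted m ℕ.+ i) m)
      ≈⟨ +ᵣ-cong acceptedLoss rejectedLoss ⟩
    fromℕ (accepted m) *ᵣ (fromℕ (A ℕ.^ l) *ᵣ ca) +ᵣ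
    (fromℕ (rejected m) *ᵣ (fromℕ (A ℕ.^ l) *ᵣ cr) +ᵣ modulusLoss k l (rejected m))
      ≈⟨ pointwise (λ n → solve 6 (λ a s w x y t → a :* (w :* x) :+ (s :* (w :* y) :+ t) :=
           w :* (a :* x :+ s :* y) :+ t) refl
           (ι (accepted m)) (ι (rejected m)) (ι (A ℕ.^ l)) (seq ca n) (seq cr n) (seq (modulusLoss k l (rejected m)) n)) ⟩
    fromℕ (A ℕ.^ l) *ᵣ splitLoss m +ᵣ modulusLoss k l (rejected m) ∎
    where
    ca cr : ℝ
    ca = log₂ m -ᵣ log₂ (accepted m)
    cr = log₂ m -ᵣ log₂ (rejected m)
    acceptedLoss : ∑< (accepted m) (λ z → wordLoss (suc k) l z m) ≃ᵣ
      fromℕ (accepted m) *ᵣ (fromℕ (A ℕ.^ l) *ᵣ ca)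
    acceptedLoss = ≃ᵣ-trans (∑<-cong (accepted m) λ z z<a → wordLoss-accept k l z m h z<a)
      (∑-const (accepted m) (fromℕ (A ℕ.^ l) *ᵣ ca))
    flip : ∀ i → m ℕ.∸ 1 ℕ.∸ (accepted m ℕ.+ i) ≡ rejected m ℕ.∸ 1 ℕ.∸ i
    flip i = trans (sym (ℕ.∸-+-assoc (m ℕ.∸ 1) (accepted m) i)) (cong (ℕ._∸ i)
      (trans (ℕ.∸-+-assoc m 1 (accepted m)) (trans (cong (m ℕ.∸_) (ℕ.+-comm 1 (accepted m)))
        (sym (ℕ.∸-+-assoc m (accepted m) 1)))))
    rejectedLoss : ∑< (rejected m) (λ i → wordLoss (suc k) l (accepted m ℕ.+ i) m) ≃ᵣ
      fromℕ (rejected m) *ᵣ (fromℕ (A ℕ.^ l) *ᵣ cr) +ᵣ modulusLoss k l (rejected m)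
    rejectedLoss = begin-equality
      ∑< (rejected m) (λ i → wordLoss (suc k) l (accepted m ℕ.+ i) m)
        ≈⟨ ∑<-cong (rejected m) (λ i _ → ≃ᵣ-trans
             (wordLoss-reject k l (accepted m ℕ.+ i) m h (ℕ.m+n≮m (accepted m) i))
             (≡⇒≃ᵣ (cong (λ t → fromℕ (A ℕ.^ l) *ᵣ cr +ᵣ wordLoss k l t (rejected m)) (flip i)))) ⟩
      ∑< (rejected m) (λ i → fromℕ (A ℕ.^ l) *ᵣ cr +ᵣ wordLoss k l (rejected m ℕ.∸ 1 ℕ.∸ i) (rejected m))
        ≈⟨ ∑-+ (rejected m) (λ _ → fromℕ (A ℕ.^ l) *ᵣ cr)
             (λ i → wordLoss k l (rejected m ℕ.∸ 1 ℕ.∸ toℕ i) (rejected m)) ⟩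
      ∑< (rejected m) (λ _ → fromℕ (A ℕ.^ l) *ᵣ cr) +ᵣ
      ∑< (rejected m) (λ i → wordLoss k l (rejected m ℕ.∸ 1 ℕ.∸ i) (rejected m))
        ≈⟨ +ᵣ-cong (∑-const (rejected m) (fromℕ (A ℕ.^ l) *ᵣ cr))
             (∑<-reverse (rejected m) λ z → wordLoss k l z (rejected m)) ⟩
      fromℕ (rejected m) *ᵣ (fromℕ (A ℕ.^ l) *ᵣ cr) +ᵣ modulusLoss k l (rejected m) ∎

  -- Leaving the reading loop means (m mod N) R < m, where m mod N is `rejected m`. If nothing were
  -- accepted, `rejected m` would be m, which contradicts this since R ≥ 1.
  splitLoss-≤ : .{{_ : NonZero R}} → ∀ B → SplitBound R B → ∀ m → ¬ m ℕ.≤ m ℕ.% N ℕ.* R →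
    splitLoss m ≤ᵣ fromℕ (accepted m) *ᵣ B
  splitLoss-≤ B split-≤ m h = from-sum m (accepted m) (rejected m) (accepted+rejected m) sR<m {{a≢0}}
    where
    -- The modulus is generalised so that matching on `refl` replaces it by a + s.
    from-sum : ∀ m a s → a ℕ.+ s ≡ m → s ℕ.* R ℕ.< m → .{{_ : NonZero a}} →
      fromℕ a *ᵣ (log₂ m -ᵣ log₂ a) +ᵣ fromℕ s *ᵣ (log₂ m -ᵣ log₂ s) ≤ᵣ fromℕ a *ᵣ B
    from-sum _ a s refl sR<m = split-≤ a s (ℕ.<⇒≤ sR<m)
    sR<m : rejected m ℕ.* R ℕ.< m
    sR<m = subst (λ t → t ℕ.* R ℕ.< m) (ℕ.m%n≡m∸m/n*n m N) (ℕ.≰⇒> h)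
    a≢0 : NonZero (accepted m)
    a≢0 = ℕ.≢-nonZero λ a≡0 → ℕ.<⇒≱ sR<m (ℕ.≤-trans
      (ℕ.≤-reflexive (sym (cong (m ℕ.∸_) a≡0)))
      (ℕ.m≤m*n (rejected m) R))

  -- The budget m Aˡ B is preserved by a read, as m Aˡ⁺¹ = (A m) Aˡ. A split divides it into a part
  -- for the accepted values, which covers the loss of the split, and a part for the rejected
  -- values, which covers what follows.
  modulusLoss-≤ : .{{_ : NonZero R}} → ∀ B → fromℚ 0ℚ ≤ᵣ B → SplitBound R B → ∀ k l m →
    modulusLoss k l m ≤ᵣ fromℕ (m ℕ.* A ℕ.^ l) *ᵣ B
  modulusLoss-≤ B 0≤B split-≤ zero l m = begin
    modulusLoss 0 l m
      ≈⟨ ∑<-zero m (λ _ _ → ≃ᵣ-trans (∑words-const {A} l (fromℚ 0ℚ)) (*ᵣ-zeroʳ (fromℕ (A ℕ.^ l)))) ⟩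
    fromℚ 0ℚ
      ≤⟨ *ᵣ-nonNeg (fromℕ-nonNeg (m ℕ.* A ℕ.^ l)) 0≤B ⟩
    fromℕ (m ℕ.* A ℕ.^ l) *ᵣ B ∎
  modulusLoss-≤ B 0≤B split-≤ (suc k) l m = cases l (m ℕ.≤? m ℕ.% N ℕ.* R)
    where
    combine : ∀ a w s B → fromℕ w *ᵣ (fromℕ a *ᵣ B) +ᵣ fromℕ (s ℕ.* w) *ᵣ B ≃ᵣ fromℕ ((a ℕ.+ s) ℕ.* w) *ᵣ B
    combine a w s B = begin-equality
      fromℕ w *ᵣ (fromℕ a *ᵣ B) +ᵣ fromℕ (s ℕ.* w) *ᵣ B   ≈⟨ +ᵣ-cong (fromℕ-*-* w a B) ≃ᵣ-refl ⟨
      fromℕ (w ℕ.* a) *ᵣ B +ᵣ fromℕ (s ℕ.* w) *ᵣ B        ≈⟨ fromℕ-+-* (w ℕ.* a) (s ℕ.* w) B ⟨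
      fromℕ (w ℕ.* a ℕ.+ s ℕ.* w) *ᵣ B                    ≈⟨ ≡⇒≃ᵣ (cong (λ t → fromℕ t *ᵣ B)
        (trans (cong (ℕ._+ s ℕ.* w) (ℕ.*-comm w a)) (sym (ℕ.*-distribʳ-+ w a s)))) ⟩
      fromℕ ((a ℕ.+ s) ℕ.* w) *ᵣ B                        ∎
    cases : ∀ l → Dec (m ℕ.≤ m ℕ.% N ℕ.* R) →
      modulusLoss (suc k) l m ≤ᵣ fromℕ (m ℕ.* A ℕ.^ l) *ᵣ B
    -- Without digits the machine waits and loses nothing; the step count still decreases.
    cases zero    (yes h) = ≤ᵣ-trans (proj₁ (modulusLoss-wait k m h)) (modulusLoss-≤ B 0≤B split-≤ k 0 m)
    cases (suc l) (yes h) = begin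
      modulusLoss (suc k) (suc l) m                          ≈⟨ modulusLoss-read k l m h ⟩
      modulusLoss k l (A ℕ.* m)                              ≤⟨ modulusLoss-≤ B 0≤B split-≤ k l (A ℕ.* m) ⟩
      fromℕ (A ℕ.* m ℕ.* A ℕ.^ l) *ᵣ B          ≈⟨ ≡⇒≃ᵣ (cong (λ t → fromℕ t *ᵣ B)
        (trans (cong (ℕ._* A ℕ.^ l) (ℕ.*-comm A m)) (ℕ.*-assoc m A (A ℕ.^ l)))) ⟩
      fromℕ (m ℕ.* A ℕ.^ suc l) *ᵣ B            ∎
    cases l (no h) = begin
      modulusLoss (suc k) l m
        ≈⟨ modulusLoss-split k l m h ⟩
      fromℕ (A ℕ.^ l) *ᵣ splitLoss m +ᵣ modulusLoss k l (rejected m)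
        ≤⟨ +ᵣ-mono-≤ (*ᵣ-monoˡ-≤ (fromℕ (A ℕ.^ l)) (fromℕ-nonNeg (A ℕ.^ l)) (splitLoss-≤ B split-≤ m h))
             (modulusLoss-≤ B 0≤B split-≤ k l (rejected m)) ⟩
      fromℕ (A ℕ.^ l) *ᵣ (fromℕ (accepted m) *ᵣ B) +ᵣ
      fromℕ (rejected m ℕ.* A ℕ.^ l) *ᵣ B
        ≈⟨ combine (accepted m) (A ℕ.^ l) (rejected m) B ⟩
      fromℕ ((accepted m ℕ.+ rejected m) ℕ.* A ℕ.^ l) *ᵣ B
        ≈⟨ ≡⇒≃ᵣ (cong (λ t → fromℕ (t ℕ.* A ℕ.^ l) *ᵣ B) (accepted+rejected m)) ⟩
      fromℕ (m ℕ.* A ℕ.^ l) *ᵣ B ∎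

-- Averaging over the law

-- `SumsTo` controls partial sums only from some index N on. As the terms are nonnegative, the sum
-- may be extended from n to n + N terms, past that index.
∑<-≤-SumsTo : ∀ {f s} → (∀ i → fromℚ 0ℚ ≤ᵣ f i) → SumsTo f s → ∀ n → ∑< n f ≤ᵣ s
∑<-≤-SumsTo {f} {s} 0≤f sums n = ≤ᵣ-approx λ ε 0<ε → extend ε (sums ε 0<ε)
  where
  extend : ∀ ε → (∃ λ N → ∀ n → N ℕ.≤ n → ∑< n f ≤ᵣ s +ᵣ fromℚ ε × s ≤ᵣ ∑< n f +ᵣ fromℚ ε) →
    ∑< n f ≤ᵣ s +ᵣ fromℚ ε
  extend ε (N , h) = begin
    ∑< n f                                ≈⟨ +ᵣ-identityʳ (∑< n f) ⟨
    ∑< n f +ᵣ fromℚ 0ℚ                    ≤⟨ +ᵣ-mono-≤ ≤ᵣ-refl (∑<-nonNeg N λ i → 0≤f (n ℕ.+ i)) ⟩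
    ∑< n f +ᵣ ∑< N (λ i → f (n ℕ.+ i))    ≈⟨ ∑<-++ n N f ⟨
    ∑< (n ℕ.+ N) f                        ≤⟨ proj₁ (h (n ℕ.+ N) (ℕ.m≤n+m N n)) ⟩
    s +ᵣ fromℚ ε                          ∎

SumsTo-nonNeg : ∀ {f s} → (∀ i → fromℚ 0ℚ ≤ᵣ f i) → SumsTo f s → fromℚ 0ℚ ≤ᵣ s
-- The partial sum with no terms is 0.
SumsTo-nonNeg 0≤f sums = ∑<-≤-SumsTo 0≤f sums 0

module _ (N R A : ℕ) .{{_ : NonZero N}} .{{_ : NonZero R}} .{{_ : NonTrivial A}}
  (μ : Law A) (uniformState : IsUniformState μ) (independentDigits : IndependentUniformDigits μ) where
  open IsUniformState uniformState

  expectedLoss : ℕ → ℕ → ℕ → ℝ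
  expectedLoss n m z = ∑words n λ u → pr μ z m u *ᵣ totalBranchLoss N R A n z m u

  1/Aⁿ : ℕ → ℚ
  1/Aⁿ n = (1/ℕ (A ℕ.^ n)) {{ℕ.m^n≢0 A n {{ℕ.nonTrivial⇒nonZero A}}}}

  expectedLoss-outside : ∀ n m z → m ℕ.≤ z → expectedLoss n m z ≃ᵣ fromℚ 0ℚ
  expectedLoss-outside n m z m≤z = begin-equality
    expectedLoss n m z
      ≈⟨ ∑words-cong n (λ u → *ᵣ-cong (pr-zero u) ≃ᵣ-refl) ⟩
    ∑words n (λ u → fromℚ 0ℚ *ᵣ totalBranchLoss N R A n z m u)
      ≈⟨ ∑words-*ˡ n (fromℚ 0ℚ) (totalBranchLoss N R A n z m) ⟩
    fromℚ 0ℚ *ᵣ wordLoss N R A n n z m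
      ≈⟨ *ᵣ-zeroˡ (wordLoss N R A n n z m) ⟩
    fromℚ 0ℚ ∎
    where
    pr-zero : ∀ u → pr μ z m u ≃ᵣ fromℚ 0ℚ
    pr-zero u = begin-equality
      pr μ z m u                       ≈⟨ independentDigits z m u ⟩
      pr μ z m [] *ᵣ fromℚ (1/Aⁿ n)    ≈⟨ *ᵣ-cong (Z<M z m m≤z) ≃ᵣ-refl ⟩
      fromℚ 0ℚ *ᵣ fromℚ (1/Aⁿ n)       ≈⟨ *ᵣ-zeroˡ (fromℚ (1/Aⁿ n)) ⟩
      fromℚ 0ℚ                         ∎

  expectedLoss-inside : ∀ n m z .{{_ : NonZero m}} → z ℕ.< m →
    expectedLoss n m z ≃ᵣ (prM μ m *ᵣ fromℚ (1/ℕ m) *ᵣ fromℚ (1/Aⁿ n)) *ᵣ wordLoss N R A n n z m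
  expectedLoss-inside n m z z<m = begin-equality
    expectedLoss n m z
      ≈⟨ ∑words-cong n (λ u → *ᵣ-cong (≃ᵣ-trans (independentDigits z m u) (*ᵣ-cong (uniform z m z<m) ≃ᵣ-refl)) ≃ᵣ-refl) ⟩
    ∑words n (λ u → c *ᵣ totalBranchLoss N R A n z m u)
      ≈⟨ ∑words-*ˡ n c (totalBranchLoss N R A n z m) ⟩
    c *ᵣ wordLoss N R A n n z m ∎
    where
    c : ℝ
    c = prM μ m *ᵣ fromℚ (1/ℕ m) *ᵣ fromℚ (1/Aⁿ n)

  prM-nonNeg : ∀ m → fromℚ 0ℚ ≤ᵣ prM μ m
  prM-nonNeg m = SumsTo-nonNeg (λ z → pr-nonNeg μ z m []) (prM-sum μ m)

  module _ (B : ℝ) (0≤B : fromℚ 0ℚ ≤ᵣ B) (split-≤ : SplitBound R B) where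

    -- The uniform weights 1/m and 1/Aⁿ cancel the number m Aⁿ of pairs of a state and a word.
    normalise : ∀ n m .{{_ : NonZero m}} p →
      (p *ᵣ fromℚ (1/ℕ m) *ᵣ fromℚ (1/Aⁿ n)) *ᵣ (fromℕ (m ℕ.* A ℕ.^ n) *ᵣ B) ≃ᵣ p *ᵣ B
    normalise n m p = pointwise λ k → trans
      (cong (λ t → (seq p k ℚ.* 1/ℕ m ℚ.* 1/Aⁿ n) ℚ.* (t ℚ.* seq B k)) (ι-* m (A ℕ.^ n)))
      (trans (solve 6 (λ p x y m a b → (p :* x :* y) :* ((m :* a) :* b) := ((m :* x) :* (a :* y)) :* (p :* b)) refl
          (seq p k) (1/ℕ m) (1/Aⁿ n) (ι m) (ι (A ℕ.^ n)) (seq B k))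
        (trans (cong₂ (λ t u → (t ℚ.* u) ℚ.* (seq p k ℚ.* seq B k)) (ι*1/ℕ m)
            (ι*1/ℕ (A ℕ.^ n) {{ℕ.m^n≢0 A n {{ℕ.nonTrivial⇒nonZero A}}}}))
          (ℚ.*-identityˡ (seq p k ℚ.* seq B k))))

    -- Since m < n, the truncation z < n keeps all of [m]; the values of z from m on have
    -- probability 0.
    expectedLoss-∑-≤ : ∀ n m → m ℕ.< n → ∑< n (expectedLoss n m) ≤ᵣ prM μ m *ᵣ B
    -- Every z lies outside the empty set [0], so the sum vanishes.
    expectedLoss-∑-≤ n zero _ = begin
      ∑< n (expectedLoss n 0)  ≈⟨ ∑<-zero n (λ z _ → expectedLoss-outside n 0 z ℕ.z≤n) ⟩
      fromℚ 0ℚ                 ≤⟨ *ᵣ-nonNeg (prM-nonNeg 0) 0≤B ⟩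
      prM μ 0 *ᵣ B             ∎
    expectedLoss-∑-≤ n m@(suc _) m<n = begin
      ∑< n (expectedLoss n m)
        ≈⟨ ≡⇒≃ᵣ (cong (λ t → ∑< t (expectedLoss n m)) (sym (ℕ.m+[n∸m]≡n (ℕ.<⇒≤ m<n)))) ⟩
      ∑< (m ℕ.+ (n ℕ.∸ m)) (expectedLoss n m)
        ≈⟨ ∑<-++ m (n ℕ.∸ m) (expectedLoss n m) ⟩
      ∑< m (expectedLoss n m) +ᵣ ∑< (n ℕ.∸ m) (λ i → expectedLoss n m (m ℕ.+ i))
        ≈⟨ +ᵣ-cong (∑<-cong m λ z z<m → expectedLoss-inside n m z z<m)
             (∑<-zero (n ℕ.∸ m) λ i _ → expectedLoss-outside n m (m ℕ.+ i) (ℕ.m≤m+n m i)) ⟩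
      ∑< m (λ z → c *ᵣ wordLoss N R A n n z m) +ᵣ fromℚ 0ℚ
        ≈⟨ +ᵣ-identityʳ (∑< m λ z → c *ᵣ wordLoss N R A n n z m) ⟩
      ∑< m (λ z → c *ᵣ wordLoss N R A n n z m)
        ≈⟨ ∑-*ˡ m c (λ z → wordLoss N R A n n (toℕ z) m) ⟩
      c *ᵣ modulusLoss N R A n n m
        ≤⟨ *ᵣ-monoˡ-≤ c 0≤c (modulusLoss-≤ N R A B 0≤B split-≤ n n m) ⟩
      c *ᵣ (fromℕ (m ℕ.* A ℕ.^ n) *ᵣ B)
        ≈⟨ normalise n m (prM μ m) ⟩
      prM μ m *ᵣ B ∎
      where
      c : ℝ
      c = prM μ m *ᵣ fromℚ (1/ℕ m) *ᵣ fromℚ (1/Aⁿ n)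
      0≤c : fromℚ 0ℚ ≤ᵣ c
      0≤c = *ᵣ-nonNeg (*ᵣ-nonNeg (prM-nonNeg m) (1/ℕ-nonNeg m))
        (1/ℕ-nonNeg (A ℕ.^ n) {{ℕ.m^n≢0 A n {{ℕ.nonTrivial⇒nonZero A}}}})

    -- The bounds for single moduli are averaged with the weights `prM μ m`, whose partial sums are
    -- at most 1.
    𝔼-≤ : 𝔼 μ (totalBranchLoss N R A) ≤∞ B
    𝔼-≤ n = begin
      ∑< n (λ m → ∑< n (expectedLoss n m))   ≤⟨ ∑<-mono-≤ n (λ m m<n → expectedLoss-∑-≤ n m m<n) ⟩
      ∑< n (λ m → prM μ m *ᵣ B)              ≈⟨ ∑<-cong n (λ m _ → *ᵣ-comm (prM μ m) B) ⟩
      ∑< n (λ m → B *ᵣ prM μ m)              ≈⟨ ∑-*ˡ n B (λ m → prM μ (toℕ m)) ⟩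
      B *ᵣ ∑< n (prM μ)                      ≤⟨ *ᵣ-monoˡ-≤ B 0≤B (∑<-≤-SumsTo prM-nonNeg (total μ) n) ⟩
      B *ᵣ fromℚ 1ℚ                          ≈⟨ *ᵣ-comm B (fromℚ 1ℚ) ⟩
      fromℚ 1ℚ *ᵣ B                          ≈⟨ *ᵣ-identityˡ B ⟩
      B                                      ∎

mainTheorem4 :
    (N R A : ℕ) .{{_ : NonZero N}} .{{_ : NonTrivial R}} .{{_ : NonTrivial A}} →
    (μ : Law A) → IsUniformState μ → IndependentUniformDigits μ →
    𝔼 μ (totalBranchLoss N R A) ≤∞ entropyBound R
mainTheorem4 N R@(suc n@(suc _)) A μ uniformState independentDigits =
  -- The pattern leaves R = n + 1 with n ≥ 1, so the factor n = R - 1 can be cancelled.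
  𝔼-≤ N R A μ uniformState independentDigits (entropyBound R)
    (scaled-nonNeg n (entropyBound R) (entropyBound-scaled n))
    (split-loss n (entropyBound R) (entropyBound-scaled n))
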